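{- Let $p\in(0,1)$ and $C_{\mathrm{ar}}\ge 1$ be constants. Let $G\sim G(n_A,n_B,p)$, where $n_A,n_B$ are positive integers with $\max(n_A,n_B)\le C_{\mathrm{ar}}\cdot\min(n_A,n_B)$. Then \[ \chi'_s(G)\le \Delta_A(G)\cdot\Delta_B(G) \] asymptotically almost surely as $\min(n_A,n_B)\to\infty$; that is, the probability of this event tends to $1$ as $\min(n_A,n_B)\to\infty$ subject to $\max(n_A,n_B)\le C_{\mathrm{ar}}\min(n_A,n_B)$.
   Context: $G(n_A,n_B,p)$ is the random bipartite graph with fixed disjoint parts $A,B$ of sizes $|A|=n_A$, $|B|=n_B$, in which each of the $n_An_B$ pairs $ab$ with $a\in A$, $b\in B$ is an edge independently with probability $p$. The side maximum degrees are $\Delta_A(G)=\max_{a\in A}\deg_G(a)$ and $\Delta_B(G)=\max_{b\in B}\deg_G(b)$. A strong edge-colouring of a graph $G$ is an assignment of colours to $E(G)$ such that any two distinct edges that share a vertex, or that are joined by a third edge of $G$ (i.e. some edge of $G$ has one endpoint in each of them), receive different colours. The strong chromatic index $\chi'_s(G)$ is the minimum number of colours in a strong edge-colouring of $G$. -}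

module Defs where

open import Data.Bool.Base using (Bool; true; false)
open import Data.Fin.Base using (Fin; zero; combine; remQuot; finToFun; funToFin)
open import Data.Fin.Properties as Fin using (all?; any?; combine-injective; finToFun-funToFin)
open import Data.Fin.Subset using (Subset; _∈_; ∣_∣)
open import Data.Fin.Subset.Properties using (_∈?_)
open import Data.Integer.Base as ℤ using ()
open import Data.List.Base as List using (List; []; _∷_)
open import Data.List.Extrema.Nat using (max)
open import Data.Nat.Base as ℕ using (ℕ; zero; suc)
import Data.Nat.Properties as ℕ
open import Data.Product using (Σ-syntax; ∃-syntax; _×_; _,_; proj₁; proj₂; uncurry)
open import Data.Product.Properties using (≡-dec)
open import Data.Rational.Base as ℚ using (ℚ; 0ℚ; 1ℚ; ½)
import Data.Rational.Properties as ℚ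
open import Data.Rational.Solver using (module +-*-Solver)
open import Data.Sum.Base using (_⊎_; inj₁; inj₂)
open import Data.Vec.Base as Vec using (Vec; []; _∷_; lookup; here; there)
open import Function.Base using (_∘_; case_of_)
open import Level using (0ℓ)
open import Relation.Binary.PropositionalEquality
  using (_≡_; _≢_; refl; sym; trans; cong; cong₂; subst; subst₂)
open import Relation.Nullary using (Dec; yes; no; contradiction)
open import Relation.Nullary.Decidable using (map′; _⊎-dec_; _→-dec_; ¬?)
open import Relation.Unary using (Pred; Decidable)

IsCauchy : (ℕ → ℚ) → Set
IsCauchy x =
  ∀ ε → 0ℚ ℚ.< ε → ∃[ N ] ∀ m n → N ℕ.≤ m → N ℕ.≤ n → ℚ.∣ x m ℚ.- x n ∣ ℚ.≤ ε

-- Two Cauchy sequences with the same limit are not identified; the relations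
-- _<_ and _≤_ below depend only on the limits.
record ℝ : Set where
  constructor mkℝ
  field
    seq    : ℕ → ℚ
    cauchy : IsCauchy seq

open ℝ public

private
  half-pos : ∀ {ε} → 0ℚ ℚ.< ε → 0ℚ ℚ.< ½ ℚ.* ε
  half-pos {ε} ε>0 = subst (ℚ._< ½ ℚ.* ε) (ℚ.*-zeroʳ ½) (ℚ.*-monoʳ-<-pos ½ ε>0)

  half+half : ∀ ε → ½ ℚ.* ε ℚ.+ ½ ℚ.* ε ≡ ε
  half+half ε = trans (sym (ℚ.*-distribʳ-+ ε ½ ½)) (ℚ.*-identityˡ ε)

  open +-*-Solver

  +-difference : ∀ a b c d → (a ℚ.- c) ℚ.+ (b ℚ.- d) ≡ (a ℚ.+ b) ℚ.- (c ℚ.+ d)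
  +-difference = solve 4 (λ a b c d →
    (a :+ (:- c)) :+ (b :+ (:- d)) := (a :+ b) :+ (:- (c :+ d))) refl

  *-difference : ∀ a b c d → a ℚ.* (b ℚ.- d) ℚ.+ d ℚ.* (a ℚ.- c) ≡ a ℚ.* b ℚ.- c ℚ.* d
  *-difference = solve 4 (λ a b c d →
    a :* (b :+ (:- d)) :+ d :* (a :+ (:- c)) := a :* b :+ (:- (c :* d))) refl

  neg-difference : ∀ a b → ℚ.- (a ℚ.- b) ≡ (ℚ.- a) ℚ.- (ℚ.- b)
  neg-difference = solve 2 (λ a b →
    :- (a :+ (:- b)) := (:- a) :+ (:- (:- b))) refl

  cancel : ∀ a b → (a ℚ.- b) ℚ.+ b ≡ a
  cancel = solve 2 (λ a b → (a :+ (:- b)) :+ b := a) refl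

  swap : ∀ a b → ℚ.- (a ℚ.- b) ≡ b ℚ.- a
  swap = solve 2 (λ a b → :- (a :+ (:- b)) := b :+ (:- a)) refl

  add-sub : ∀ d b → (d ℚ.+ b) ℚ.- b ≡ d
  add-sub = solve 2 (λ d b → (d :+ b) :+ (:- b) := d) refl

  ∣∣-triangle : ∀ a b → ℚ.∣ a ∣ ℚ.- ℚ.∣ b ∣ ℚ.≤ ℚ.∣ a ℚ.- b ∣
  ∣∣-triangle a b = subst (ℚ.∣ a ∣ ℚ.- ℚ.∣ b ∣ ℚ.≤_) (add-sub ℚ.∣ a ℚ.- b ∣ ℚ.∣ b ∣)
    (ℚ.+-monoˡ-≤ (ℚ.- ℚ.∣ b ∣)
      (subst (λ t → ℚ.∣ t ∣ ℚ.≤ ℚ.∣ a ℚ.- b ∣ ℚ.+ ℚ.∣ b ∣) (cancel a b)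
        (ℚ.∣p+q∣≤∣p∣+∣q∣ (a ℚ.- b) b)))

  ∣-∣-swap : ∀ a b → ℚ.∣ a ℚ.- b ∣ ≡ ℚ.∣ b ℚ.- a ∣
  ∣-∣-swap a b = trans (sym (ℚ.∣-p∣≡∣p∣ (a ℚ.- b))) (cong ℚ.∣_∣ (swap a b))

  ∣∣-lipschitz : ∀ a b → ℚ.∣ ℚ.∣ a ∣ ℚ.- ℚ.∣ b ∣ ∣ ℚ.≤ ℚ.∣ a ℚ.- b ∣
  ∣∣-lipschitz a b with ℚ.∣p∣≡p∨∣p∣≡-p (ℚ.∣ a ∣ ℚ.- ℚ.∣ b ∣)
  ... | inj₁ eq = subst (ℚ._≤ ℚ.∣ a ℚ.- b ∣) (sym eq) (∣∣-triangle a b)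
  ... | inj₂ eq = subst₂ ℚ._≤_ (sym (trans eq (swap ℚ.∣ a ∣ ℚ.∣ b ∣))) (∣-∣-swap b a)
                    (∣∣-triangle b a)

  eventually-bounded : ∀ {x} → IsCauchy x →
    ∃[ B ] ∃[ N ] ℚ.Positive B × (∀ n → N ℕ.≤ n → ℚ.∣ x n ∣ ℚ.≤ B)
  eventually-bounded {x} x-cauchy with N , close ← x-cauchy 1ℚ (ℚ.positive⁻¹ 1ℚ) =
    1ℚ ℚ.+ ℚ.∣ x N ∣ , N
    , ℚ.pos+nonNeg⇒pos 1ℚ ℚ.∣ x N ∣ {{ℚ.∣-∣-nonNeg (x N)}}
    , λ n N≤n → ℚ.≤-trans
        (subst (λ t → ℚ.∣ t ∣ ℚ.≤ ℚ.∣ x n ℚ.- x N ∣ ℚ.+ ℚ.∣ x N ∣) (cancel (x n) (x N))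
          (ℚ.∣p+q∣≤∣p∣+∣q∣ (x n ℚ.- x N) (x N)))
        (ℚ.+-monoˡ-≤ ℚ.∣ x N ∣ (close n N N≤n ℕ.≤-refl))

  ≤-⊔ˡ : ∀ {M N n} → M ℕ.⊔ N ℕ.≤ n → M ℕ.≤ n
  ≤-⊔ˡ {M} {N} = ℕ.≤-trans (ℕ.m≤m⊔n M N)

  ≤-⊔ʳ : ∀ {M N n} → M ℕ.⊔ N ℕ.≤ n → N ℕ.≤ n
  ≤-⊔ʳ {M} {N} = ℕ.≤-trans (ℕ.m≤n⊔m M N)

  +-cauchy : ∀ {x y} → IsCauchy x → IsCauchy y → IsCauchy (λ k → x k ℚ.+ y k)
  +-cauchy {x} {y} x-cauchy y-cauchy ε ε>0
    with M , x-close ← x-cauchy (½ ℚ.* ε) (half-pos ε>0)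
    with N , y-close ← y-cauchy (½ ℚ.* ε) (half-pos ε>0) =
    M ℕ.⊔ N , λ m n m≥ n≥ → ℚ.≤-trans
      (subst (λ t → ℚ.∣ t ∣ ℚ.≤ ℚ.∣ x m ℚ.- x n ∣ ℚ.+ ℚ.∣ y m ℚ.- y n ∣)
        (+-difference (x m) (y m) (x n) (y n))
        (ℚ.∣p+q∣≤∣p∣+∣q∣ (x m ℚ.- x n) (y m ℚ.- y n)))
      (ℚ.≤-trans
        (ℚ.+-mono-≤ (x-close m n (≤-⊔ˡ m≥) (≤-⊔ˡ n≥))
                    (y-close m n (≤-⊔ʳ m≥) (≤-⊔ʳ n≥)))
        (ℚ.≤-reflexive (half+half ε)))

  neg-cauchy : ∀ {x} → IsCauchy x → IsCauchy (λ k → ℚ.- x k)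
  neg-cauchy {x} x-cauchy ε ε>0 with N , close ← x-cauchy ε ε>0 =
    N , λ m n m≥ n≥ → subst (ℚ._≤ ε)
      (trans (sym (ℚ.∣-p∣≡∣p∣ (x m ℚ.- x n))) (cong ℚ.∣_∣ (neg-difference (x m) (x n))))
      (close m n m≥ n≥)

  ∣∣-cauchy : ∀ {x} → IsCauchy x → IsCauchy (λ k → ℚ.∣ x k ∣)
  ∣∣-cauchy {x} x-cauchy ε ε>0 with N , close ← x-cauchy ε ε>0 =
    N , λ m n m≥ n≥ → ℚ.≤-trans (∣∣-lipschitz (x m) (x n)) (close m n m≥ n≥)

  ∣*∣-≤ : ∀ {a b A B} → ℚ.NonNegative A → ℚ.∣ a ∣ ℚ.≤ A → ℚ.∣ b ∣ ℚ.≤ B →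
          ℚ.∣ a ℚ.* b ∣ ℚ.≤ A ℚ.* B
  ∣*∣-≤ {a} {b} {A} {B} A≥0 a≤A b≤B =
    ℚ.≤-trans (ℚ.≤-reflexive (ℚ.∣p*q∣≡∣p∣*∣q∣ a b))
      (ℚ.≤-trans (ℚ.*-monoʳ-≤-nonNeg ℚ.∣ b ∣ {{ℚ.∣-∣-nonNeg b}} a≤A)
                 (ℚ.*-monoˡ-≤-nonNeg A {{A≥0}} b≤B))

  *-difference-≤ : ∀ a b c d {A B δ} → ℚ.NonNegative A → ℚ.NonNegative B →
    ℚ.∣ a ∣ ℚ.≤ A → ℚ.∣ d ∣ ℚ.≤ B → ℚ.∣ a ℚ.- c ∣ ℚ.≤ δ → ℚ.∣ b ℚ.- d ∣ ℚ.≤ δ →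
    ℚ.∣ a ℚ.* b ℚ.- c ℚ.* d ∣ ℚ.≤ A ℚ.* δ ℚ.+ B ℚ.* δ
  *-difference-≤ a b c d {A} {B} {δ} A≥0 B≥0 a≤A d≤B a≈c b≈d = ℚ.≤-trans
    (subst (λ t → ℚ.∣ t ∣ ℚ.≤ ℚ.∣ a ℚ.* (b ℚ.- d) ∣ ℚ.+ ℚ.∣ d ℚ.* (a ℚ.- c) ∣)
      (*-difference a b c d)
      (ℚ.∣p+q∣≤∣p∣+∣q∣ (a ℚ.* (b ℚ.- d)) (d ℚ.* (a ℚ.- c))))
    (ℚ.+-mono-≤ (∣*∣-≤ {a} {b ℚ.- d} A≥0 a≤A b≈d) (∣*∣-≤ {d} {a ℚ.- c} B≥0 d≤B a≈c))

  split : ∀ ε A B → 0ℚ ℚ.< ε → ℚ.Positive A → ℚ.Positive B →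
          ∃[ δ ] 0ℚ ℚ.< δ × A ℚ.* δ ℚ.+ B ℚ.* δ ≡ ε
  split ε A B ε>0 A>0 B>0 = ε ℚ.* c
    , subst (ℚ._< ε ℚ.* c) (ℚ.*-zeroˡ c)
        (ℚ.*-monoˡ-<-pos c {{ℚ.1/pos⇒pos S {{S>0}}}} ε>0)
    , trans (sym (ℚ.*-distribʳ-+ (ε ℚ.* c) A B))
        (trans (ℚ.*-comm S (ε ℚ.* c))
        (trans (ℚ.*-assoc ε c S)
        (trans (cong (ε ℚ.*_) (ℚ.*-inverseˡ S {{S≢0}})) (ℚ.*-identityʳ ε))))
    where
    S : ℚ
    S = A ℚ.+ B
    S>0 : ℚ.Positive S
    S>0 = ℚ.pos+pos⇒pos A {{A>0}} B {{B>0}}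
    S≢0 : ℚ.NonZero S
    S≢0 = ℚ.pos⇒nonZero S {{S>0}}
    c : ℚ
    c = (ℚ.1/ S) {{S≢0}}

  *-cauchy : ∀ {x y} → IsCauchy x → IsCauchy y → IsCauchy (λ k → x k ℚ.* y k)
  *-cauchy {x} {y} x-cauchy y-cauchy ε ε>0 =
    let A , K , A>0 , x≤A = eventually-bounded {x} x-cauchy
        B , L , B>0 , y≤B = eventually-bounded {y} y-cauchy
        δ , δ>0 , Aδ+Bδ≡ε = split ε A B ε>0 A>0 B>0
        M , x-close = x-cauchy δ δ>0
        N , y-close = y-cauchy δ δ>0
    in combine-bounds {A} {K} {B} {L} {δ} {M} {N} A>0 x≤A B>0 y≤B Aδ+Bδ≡ε x-close y-close
    where
    combine-bounds : ∀ {A K B L δ M N} → ℚ.Positive A → (∀ n → K ℕ.≤ n → ℚ.∣ x n ∣ ℚ.≤ A) →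
      ℚ.Positive B → (∀ n → L ℕ.≤ n → ℚ.∣ y n ∣ ℚ.≤ B) → A ℚ.* δ ℚ.+ B ℚ.* δ ≡ ε →
      (∀ m n → M ℕ.≤ m → M ℕ.≤ n → ℚ.∣ x m ℚ.- x n ∣ ℚ.≤ δ) →
      (∀ m n → N ℕ.≤ m → N ℕ.≤ n → ℚ.∣ y m ℚ.- y n ∣ ℚ.≤ δ) →
      ∃[ R ] ∀ m n → R ℕ.≤ m → R ℕ.≤ n → ℚ.∣ x m ℚ.* y m ℚ.- x n ℚ.* y n ∣ ℚ.≤ ε
    combine-bounds {A} {K} {B} {L} {δ} {M} {N} A>0 x≤A B>0 y≤B Aδ+Bδ≡ε x-close y-close =
      (K ℕ.⊔ L) ℕ.⊔ (M ℕ.⊔ N) , λ m n m≥ n≥ →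
      let m≥MN = ≤-⊔ʳ {K ℕ.⊔ L} {M ℕ.⊔ N} m≥
          n≥MN = ≤-⊔ʳ {K ℕ.⊔ L} {M ℕ.⊔ N} n≥
          m≥KL = ≤-⊔ˡ {K ℕ.⊔ L} {M ℕ.⊔ N} m≥
          n≥KL = ≤-⊔ˡ {K ℕ.⊔ L} {M ℕ.⊔ N} n≥
      in subst (ℚ.∣ x m ℚ.* y m ℚ.- x n ℚ.* y n ∣ ℚ.≤_) Aδ+Bδ≡ε
        (*-difference-≤ (x m) (y m) (x n) (y n) {A} {B} {δ}
          (ℚ.pos⇒nonNeg A {{A>0}}) (ℚ.pos⇒nonNeg B {{B>0}})
          (x≤A m (≤-⊔ˡ {K} {L} m≥KL)) (y≤B n (≤-⊔ʳ {K} {L} n≥KL))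
          (x-close m n (≤-⊔ˡ {M} {N} m≥MN) (≤-⊔ˡ {M} {N} n≥MN))
          (y-close m n (≤-⊔ʳ {M} {N} m≥MN) (≤-⊔ʳ {M} {N} n≥MN)))

fromℚ : ℚ → ℝ
fromℚ q .seq _ = q
fromℚ q .cauchy ε ε>0 = 0 , λ _ _ _ _ →
  subst (λ t → ℚ.∣ t ∣ ℚ.≤ ε) (sym (ℚ.+-inverseʳ q)) (ℚ.<⇒≤ ε>0)

fromℕ : ℕ → ℝ
fromℕ n = fromℚ (ℤ.+ n ℚ./ 1)

0ℝ 1ℝ : ℝ
0ℝ = fromℚ 0ℚ
1ℝ = fromℚ 1ℚ

infixl 7 _*_
infixl 6 _+_ _-_
infix  8 -_
infix  4 _<_ _≤_

_+_ _*_ : ℝ → ℝ → ℝ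
(x + y) .seq k = x .seq k ℚ.+ y .seq k
(x + y) .cauchy = +-cauchy {x .seq} {y .seq} (x .cauchy) (y .cauchy)

(x * y) .seq k = x .seq k ℚ.* y .seq k
(x * y) .cauchy = *-cauchy {x .seq} {y .seq} (x .cauchy) (y .cauchy)

-_ : ℝ → ℝ
(- x) .seq k = ℚ.- x .seq k
(- x) .cauchy = neg-cauchy {x .seq} (x .cauchy)

_-_ : ℝ → ℝ → ℝ
x - y = x + (- y)

abs : ℝ → ℝ
abs x .seq k = ℚ.∣ x .seq k ∣
abs x .cauchy = ∣∣-cauchy {x .seq} (x .cauchy)

-- The gap ε is needed: termwise strict inequality can vanish in the limit.
_<_ : ℝ → ℝ → Set
x < y = ∃[ ε ] 0ℚ ℚ.< ε × ∃[ N ] ∀ k → N ℕ.≤ k → x .seq k ℚ.+ ε ℚ.≤ y .seq k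

_≤_ : ℝ → ℝ → Set
x ≤ y = ∀ ε → 0ℚ ℚ.< ε → ∃[ N ] ∀ k → N ℕ.≤ k → x .seq k ℚ.≤ y .seq k ℚ.+ ε

∑ : List ℝ → ℝ
∑ = List.foldr _+_ 0ℝ

∏ : ∀ {n} → Vec ℝ n → ℝ
∏ = Vec.foldr′ _*_ 1ℝ

-- A bipartite graph with parts A = Fin nA and B = Fin nB: the a-th entry is
-- the neighbourhood of the vertex a of A.
Graph : ℕ → ℕ → Set
Graph nA nB = Vec (Subset nB) nA

private
  ∈-irrelevant : ∀ {n} {S : Subset n} {x} (e f : x ∈ S) → e ≡ f
  ∈-irrelevant here      here      = refl
  ∈-irrelevant (there e) (there f) = cong there (∈-irrelevant e f)

module _ {nA nB : ℕ} (G : Graph nA nB) where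

  Adj : Fin nA → Fin nB → Set
  Adj a b = b ∈ lookup G a

  Edge : Set
  Edge = Σ[ (a , b) ∈ Fin nA × Fin nB ] Adj a b

  neighboursA : Fin nA → Subset nB
  neighboursA a = lookup G a

  neighboursB : Fin nB → Subset nA
  neighboursB b = Vec.map (λ N → lookup N b) G

  ΔA : ℕ
  ΔA = max 0 (List.map (λ a → ∣ neighboursA a ∣) (List.allFin nA))

  ΔB : ℕ
  ΔB = max 0 (List.map (λ b → ∣ neighboursB b ∣) (List.allFin nB))

  ShareVertex : Edge → Edge → Set
  ShareVertex ((a , b) , _) ((a′ , b′) , _) = a ≡ a′ ⊎ b ≡ b′

  -- Each edge has one endpoint in A and one in B, so an edge with one endpoint
  -- in each of ab and a′b′ is either ab′ or a′b.
  JoinedByEdge : Edge → Edge → Set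
  JoinedByEdge ((a , b) , _) ((a′ , b′) , _) = Adj a b′ ⊎ Adj a′ b

  record StrongEdgeColouring (k : ℕ) : Set where
    field
      colour : Edge → Fin k
      strong : ∀ e f → e ≢ f → ShareVertex e f ⊎ JoinedByEdge e f → colour e ≢ colour f

  open StrongEdgeColouring

  private
    StrongMatrix : ∀ {k} → (Fin nA → Fin nB → Fin k) → Set
    StrongMatrix c = ∀ a b a′ b′ → Adj a b → Adj a′ b′ → (a , b) ≢ (a′ , b′) →
      (a ≡ a′ ⊎ b ≡ b′) ⊎ (Adj a b′ ⊎ Adj a′ b) → c a b ≢ c a′ b′

    adj? : ∀ a b → Dec (Adj a b)
    adj? a b = b ∈? lookup G a

    strongMatrix? : ∀ {k} (c : Fin nA → Fin nB → Fin k) → Dec (StrongMatrix c)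
    strongMatrix? c = all? λ a → all? λ b → all? λ a′ → all? λ b′ →
      adj? a b →-dec adj? a′ b′ →-dec ¬? (≡-dec Fin._≟_ Fin._≟_ (a , b) (a′ , b′)) →-dec
      ((a Fin.≟ a′ ⊎-dec b Fin.≟ b′) ⊎-dec (adj? a b′ ⊎-dec adj? a′ b)) →-dec
      ¬? (c a b Fin.≟ c a′ b′)

    edge-≡ : ∀ {a b a′ b′} (e : Adj a b) (f : Adj a′ b′) → (a , b) ≡ (a′ , b′) →
             _≡_ {A = Edge} ((a , b) , e) ((a′ , b′) , f)
    edge-≡ e f refl = cong (_ ,_) (∈-irrelevant e f)

    fromMatrix : ∀ {k} (c : Fin nA → Fin nB → Fin k) → StrongMatrix c → StrongEdgeColouring k
    fromMatrix c c-strong .colour ((a , b) , _) = c a b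
    fromMatrix c c-strong .strong ((a , b) , e) ((a′ , b′) , f) e≢f =
      c-strong a b a′ b′ e f (e≢f ∘ edge-≡ e f)

    toMatrix : ∀ {k} → StrongEdgeColouring (suc k) → Fin nA → Fin nB → Fin (suc k)
    toMatrix col a b with adj? a b
    ... | yes e = col .colour ((a , b) , e)
    ... | no  _ = zero

    toMatrix-≡ : ∀ {k} (col : StrongEdgeColouring (suc k)) {a b} (e : Adj a b) →
                 toMatrix col a b ≡ col .colour ((a , b) , e)
    toMatrix-≡ col {a} {b} e with adj? a b
    ... | yes e′ = cong (col .colour) (edge-≡ e′ e refl)
    ... | no ¬e  = contradiction e ¬e

    toMatrix-strong : ∀ {k} (col : StrongEdgeColouring (suc k)) → StrongMatrix (toMatrix col)
    toMatrix-strong col a b a′ b′ e f ab≢ab′ near eq =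
      col .strong (_ , e) (_ , f) (ab≢ab′ ∘ cong proj₁) near
        (trans (sym (toMatrix-≡ col e)) (trans eq (toMatrix-≡ col f)))

    decode : ∀ {k} → Fin (k ℕ.^ (nA ℕ.* nB)) → Fin nA → Fin nB → Fin k
    decode i a b = finToFun i (combine a b)

    encode : ∀ {k} → (Fin nA → Fin nB → Fin k) → Fin (k ℕ.^ (nA ℕ.* nB))
    encode c = funToFin (uncurry c ∘ remQuot nB)

    decode-encode : ∀ {k} (c : Fin nA → Fin nB → Fin k) a b → decode (encode c) a b ≡ c a b
    decode-encode c a b = trans (finToFun-funToFin (uncurry c ∘ remQuot nB) (combine a b))
      (cong (uncurry c) (Fin.remQuot-combine a b))

  strongEdgeColouring? : ∀ k → Dec (StrongEdgeColouring k)
  strongEdgeColouring? zero = map′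
    (λ no-edge → record
      { colour = λ { ((a , b) , e) → contradiction e (no-edge a b) }
      ; strong = λ { ((a , b) , e) → contradiction e (no-edge a b) } })
    (λ col a b e → case col .colour ((a , b) , e) of λ ())
    (all? λ a → all? λ b → ¬? (adj? a b))
  strongEdgeColouring? (suc k) = map′
    (λ (i , i-strong) → fromMatrix (decode i) i-strong)
    (λ col → encode (toMatrix col) , λ a b a′ b′ e f ab≢ab′ near eq →
      toMatrix-strong col a b a′ b′ e f ab≢ab′ near
        (trans (sym (decode-encode (toMatrix col) a b))
          (trans eq (decode-encode (toMatrix col) a′ b′))))
    (any? λ i → strongMatrix? (decode {suc k} i))

  private
    rainbow : StrongEdgeColouring (nA ℕ.* nB)
    rainbow = fromMatrix combine λ a b a′ b′ _ _ ab≢ab′ _ eq →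
      ab≢ab′ (uncurry (cong₂ _,_) (combine-injective a b a′ b′ eq))

    least : ∀ {P : Pred ℕ 0ℓ} → Decidable P → ∀ n → P n → ∃[ k ] P k × (∀ j → P j → k ℕ.≤ j)
    least P? zero    p = zero , p , λ _ _ → ℕ.z≤n
    least P? (suc n) p with P? zero
    ... | yes p₀ = zero , p₀ , λ _ _ → ℕ.z≤n
    ... | no ¬p₀ with least (P? ∘ suc) n p
    ...   | k , pₖ , k-min = suc k , pₖ , λ
            { zero p₀ → contradiction p₀ ¬p₀ ; (suc j) pⱼ → ℕ.s≤s (k-min j pⱼ) }

  minimumColours : ∃[ k ] StrongEdgeColouring k × (∀ j → StrongEdgeColouring j → k ℕ.≤ j)
  minimumColours = least strongEdgeColouring? (nA ℕ.* nB) rainbow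

  χ′ₛ : ℕ
  χ′ₛ = proj₁ minimumColours

vectors : ∀ {A : Set} → List A → ∀ n → List (Vec A n)
vectors xs zero    = [] ∷ []
vectors xs (suc n) = List.cartesianProductWith _∷_ xs (vectors xs n)

graphs : ∀ nA nB → List (Graph nA nB)
graphs nA nB = vectors (vectors (true ∷ false ∷ []) nB) nA

bernoulli : ℝ → Bool → ℝ
bernoulli p true  = p
bernoulli p false = 1ℝ - p

-- The probability that G(nA , nB , p) equals the given graph.
weight : ∀ {nA nB} → ℝ → Graph nA nB → ℝ
weight p G = ∏ (Vec.map (λ N → ∏ (Vec.map (bernoulli p) N)) G)

ℙ : ∀ nA nB → ℝ → {E : Pred (Graph nA nB) 0ℓ} → Decidable E → ℝ
ℙ nA nB p E? = ∑ (List.map (weight p) (List.filter E? (graphs nA nB)))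

{-# OPTIONS --safe #-}
-- Since ΔA * ΔB is of order nA * nB with high probability (one row and one column
-- suffice, by Chebyshev), it is enough to colour with o(nA * nB) colours on average
-- and to apply Markov's inequality.  Split the vertices on either side into blocks
-- indexed by (Fin k)ᵀ.  In round t < T, the cells of a product of two blocks are
-- partitioned into matchings of k cells that move in direction t only; such a chunk is
-- good, with probability ρ = (1 - p)^(k(k-1)), if none of its off-diagonal cells is an
-- edge, and then it can be one colour class.  The T chunks through a given cell are
-- good independently of each other, so the cell lies in no good chunk with probability
-- (1 - ρ)ᵀ and then gets its own colour.  Per cell this costs T ρ / k + (1 - ρ)ᵀ
-- colours on average, which is small for T ρ ≈ H, k ≈ H² and H large.
module Submission where

-- A real edge probability is a Cauchy sequence of rationals, and each late term is an edge
-- probability of its own, so one bound on the sizes must serve for all of them. Hence the argument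
-- is run for a rational `p` about which only `1ℚ ≤ ι Q * p` and `1ℚ ≤ ι Q * (1ℚ - p)` are known.
-- The number T of rounds depends on `p` through ρ, but it is at most S = H Q^ℓ, where ℓ is the
-- number of off-diagonal cells of a chunk; the bound on the sizes is stated with S, so it does not
-- move with `p`. The constants are found backwards. Degrees above n / (2Q) on either side give a
-- product above nA nB / (4 Q²). For a failure probability of at most 1 / R, Markov's inequality
-- then asks for an expectation of at most nA nB / h colours, with h = 4 Q² R. Leftover cells, good
-- chunks and uncovered cells share this budget equally, whence H = 3 h. Reciprocals are handled as
-- integers `n` with `1ℚ ≤ ι n * x`, which turns the conditions on the sizes into inequalities
-- between natural numbers.

module _ where

  open import Algebra.Bundles using (module CommutativeRing)
  import Algebra.Properties.Semiring.Mult as Mult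
  open import Data.Bool.Base using (Bool; true; false)
  import Data.Bool.Properties as Bool
  open import Data.Fin.Base as Fin
    using (Fin; zero; suc; toℕ; fromℕ<; _↑ˡ_; _↑ʳ_; splitAt; combine; remQuot; punchIn; punchOut)
  import Data.Fin.Properties as Fin
  open import Data.Fin.Subset using (∣_∣)
  open import Data.Integer.Base as ℤ using ()
  import Data.Integer.Properties as ℤ
  open import Data.List.Base as List
    using (List; []; _∷_; _++_; length; allFin; cartesianProduct; cartesianProductWith)
  import Data.List.Extrema.Nat as Extrema
  import Data.List.Properties as List
  open import Data.List.Membership.Propositional using (_∈_; _∉_)
  import Data.List.Membership.Propositional.Properties as ∈
  open import Data.List.Relation.Binary.Disjoint.Propositional using (Disjoint)
  open import Data.List.Relation.Unary.All as All using (All; []; _∷_)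
  import Data.List.Relation.Unary.All.Properties as All
  open import Data.List.Relation.Unary.AllPairs as AllPairs using (AllPairs; []; _∷_)
  import Data.List.Relation.Unary.AllPairs.Properties as AllPairs
  open import Data.List.Relation.Unary.Any as Any using (Any; here; there)
  import Data.List.Relation.Unary.Any.Properties as Any
  open import Data.List.Relation.Unary.Unique.Propositional using (Unique)
  import Data.List.Relation.Unary.Unique.Propositional.Properties as Unique
  open import Data.Nat.Base as ℕ using (ℕ; zero; suc; z<s; _⊔_; _⊓_)
  import Data.Nat.DivMod as ℕ
  import Data.Nat.Properties as ℕ
  open import Data.Nat.Tactic.RingSolver using (solve-∀)
  open import Data.Product using (Σ-syntax; ∃-syntax; _×_; _,_; proj₁; proj₂; uncurry)
  open import Data.Rational.Base as ℚ hiding (∣_∣; _⊔_; _⊓_)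
  open import Data.Rational.Properties
  open import Data.Rational.Solver using (module +-*-Solver)
  import Data.Rational.Unnormalised.Base as ℚᵘ
  import Data.Rational.Unnormalised.Properties as ℚᵘ
  open import Data.Sum.Base using (_⊎_; inj₁; inj₂)
  open import Data.Vec.Base as Vec using (Vec; []; _∷_; lookup; updateAt; insertAt; removeAt)
  import Data.Vec.Properties as Vec
  open import Defs hiding (_+_; _*_; -_; _-_; _<_; _≤_)
  import Defs
  open import Function.Base using (_∘_; const)
  open import Level using (0ℓ)
  open import Relation.Binary.PropositionalEquality
  open import Relation.Nullary using (Dec; yes; no; ¬_; contradiction)
  open import Relation.Nullary.Decidable using (¬?; decidable-stable)
  open import Relation.Unary using (Pred; Decidable)

  open CommutativeRing +-*-commutativeRing using (semiring)
  open Mult semiring using (×-homo-+; ×1-homo-*) renaming (_×_ to _·_)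
  open +-*-Solver using (solve; _:+_; _:*_; :-_; _:-_; _:=_; con)

  -- Inequalities, natural multiples and powers in ℚ

  *-monoˡ : ∀ {r p q} → 0ℚ ≤ r → p ≤ q → r * p ≤ r * q
  *-monoˡ {r} 0≤r = *-monoˡ-≤-nonNeg r {{nonNegative 0≤r}}

  *-monoʳ : ∀ {r p q} → 0ℚ ≤ r → p ≤ q → p * r ≤ q * r
  *-monoʳ {r} 0≤r = *-monoʳ-≤-nonNeg r {{nonNegative 0≤r}}

  *-mono : ∀ {p q r s} → 0ℚ ≤ q → 0ℚ ≤ r → p ≤ q → r ≤ s → p * r ≤ q * s
  *-mono 0≤q 0≤r p≤q r≤s = ≤-trans (*-monoʳ 0≤r p≤q) (*-monoˡ 0≤q r≤s)

  0≤+ : ∀ {p q} → 0ℚ ≤ p → 0ℚ ≤ q → 0ℚ ≤ p + q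
  0≤+ = +-mono-≤

  0≤* : ∀ {p q} → 0ℚ ≤ p → 0ℚ ≤ q → 0ℚ ≤ p * q
  0≤* {p} 0≤p 0≤q = ≤-trans (≤-reflexive (sym (*-zeroʳ p))) (*-monoˡ 0≤p 0≤q)

  p≤q⇒0≤q-p : ∀ {p q} → p ≤ q → 0ℚ ≤ q - p
  p≤q⇒0≤q-p {p} p≤q = ≤-trans (≤-reflexive (sym (+-inverseʳ p))) (+-monoˡ-≤ (- p) p≤q)

  0≤q-p⇒p≤q : ∀ {p q} → 0ℚ ≤ q - p → p ≤ q
  0≤q-p⇒p≤q {p} {q} h = subst₂ _≤_ (+-identityˡ p)
    (solve 2 (λ p q → (q :- p) :+ p := q) refl p q) (+-monoˡ-≤ p h)

  0≤p² : ∀ p → 0ℚ ≤ p * p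
  0≤p² p with ≤-total 0ℚ p
  ... | inj₁ 0≤p = 0≤* 0≤p 0≤p
  ... | inj₂ p≤0 = subst (0ℚ ≤_) (solve 1 (λ p → (:- p) :* (:- p) := p :* p) refl p)
                     (0≤* (neg-antimono-≤ p≤0) (neg-antimono-≤ p≤0))

  *-cancelˡ : ∀ {r p q} → 0ℚ < r → r * p ≤ r * q → p ≤ q
  *-cancelˡ {r} 0<r = *-cancelˡ-≤-pos r {{positive 0<r}}

  0≤1 : 0ℚ ≤ 1ℚ
  0≤1 = nonNegative⁻¹ 1ℚ

  0<1 : 0ℚ < 1ℚ
  0<1 = positive⁻¹ 1ℚ

  -- Iterated addition makes `ι (suc n)` compute to `1ℚ + ι n`, a form that inductions and the ring
  -- solver can use; a fraction with denominator 1 would first have to be normalised.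
  ι : ℕ → ℚ
  ι n = n · 1ℚ

  ι-+ : ∀ m n → ι (m ℕ.+ n) ≡ ι m + ι n
  ι-+ = ×-homo-+ 1ℚ

  ι-* : ∀ m n → ι (m ℕ.* n) ≡ ι m * ι n
  ι-* = ×1-homo-*

  0≤ι : ∀ n → 0ℚ ≤ ι n
  0≤ι zero    = ≤-refl
  0≤ι (suc n) = 0≤+ 0≤1 (0≤ι n)

  ι-mono : ∀ {m n} → m ℕ.≤ n → ι m ≤ ι n
  ι-mono {n = n} ℕ.z≤n = 0≤ι n
  ι-mono (ℕ.s≤s m≤n) = +-monoʳ-≤ 1ℚ (ι-mono m≤n)

  0<ι : ∀ {n} → 0 ℕ.< n → 0ℚ < ι n
  0<ι 0<n = <-≤-trans (subst (0ℚ <_) (sym (+-identityʳ 1ℚ)) 0<1) (ι-mono 0<n)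

  toℚᵘ-ι : ∀ n → toℚᵘ (ι n) ℚᵘ.≃ ℚᵘ.mkℚᵘ (ℤ.+ n) 0
  toℚᵘ-ι zero    = ℚᵘ.≃-refl
  toℚᵘ-ι (suc n) = ℚᵘ.≃-trans (toℚᵘ-homo-+ 1ℚ (ι n))
    (ℚᵘ.≃-trans (ℚᵘ.+-congʳ (toℚᵘ 1ℚ) (toℚᵘ-ι n))
    (ℚᵘ.*≡* (cong (λ m → (ℤ.+ 1 ℤ.+ m) ℤ.* ℤ.+ 1) (ℤ.*-identityʳ (ℤ.+ n)))))

  -- The absolute value of the numerator serves, because the denominator `suc d` is at least 1.
  archimedean : ∀ q → ∃[ n ] q ≤ ι n
  archimedean q@(mkℚ num d _) = ℤ.∣ num ∣ , toℚᵘ-cancel-≤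
    (ℚᵘ.≤-trans (ℚᵘ.*≤* (ineq num)) (ℚᵘ.≤-reflexive (ℚᵘ.≃-sym (toℚᵘ-ι ℤ.∣ num ∣))))
    where
    ineq : ∀ i → i ℤ.* ℤ.+ 1 ℤ.≤ ℤ.+ ℤ.∣ i ∣ ℤ.* ℤ.+ suc d
    ineq (ℤ.+ n)    = subst (ℤ._≤ ℤ.+ n ℤ.* ℤ.+ suc d) (sym (ℤ.*-identityʳ (ℤ.+ n)))
                      (subst (ℤ.+ n ℤ.≤_) (ℤ.pos-* n (suc d)) (ℤ.+≤+ (ℕ.m≤m*n n (suc d))))
    ineq ℤ.-[1+ n ] = subst (ℤ.-[1+ n ] ℤ.* ℤ.+ 1 ℤ.≤_) (ℤ.pos-* (suc n) (suc d)) ℤ.-≤+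

  1/-inverse : ∀ {x} → 0ℚ < x → ∃[ n ] 1ℚ ≤ ι n * x
  1/-inverse {x} 0<x = n , ≤-trans (≤-reflexive (sym (*-inverseˡ x {{x≢0}}))) (*-monoʳ (<⇒≤ 0<x) 1/x≤n)
    where
    x≢0 : NonZero x
    x≢0 = pos⇒nonZero x {{positive 0<x}}
    bound : ∃[ n ] (1/ x) {{x≢0}} ≤ ι n
    bound = archimedean ((1/ x) {{x≢0}})
    n : ℕ
    n = proj₁ bound
    1/x≤n : (1/ x) {{x≢0}} ≤ ι n
    1/x≤n = proj₂ bound

  infixr 8 _^_
  _^_ : ℚ → ℕ → ℚ
  x ^ zero  = 1ℚ
  x ^ suc n = x * x ^ n

  0≤^ : ∀ {x} n → 0ℚ ≤ x → 0ℚ ≤ x ^ n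
  0≤^ zero    0≤x = 0≤1
  0≤^ (suc n) 0≤x = 0≤* 0≤x (0≤^ n 0≤x)

  ^≤1 : ∀ {x} n → 0ℚ ≤ x → x ≤ 1ℚ → x ^ n ≤ 1ℚ
  ^≤1 zero    0≤x x≤1 = ≤-refl
  ^≤1 {x} (suc n) 0≤x x≤1 = subst (x * x ^ n ≤_) (*-identityˡ 1ℚ) (*-mono 0≤1 (0≤^ n 0≤x) x≤1 (^≤1 n 0≤x x≤1))

  ^-distrib-* : ∀ x y n → (x * y) ^ n ≡ x ^ n * y ^ n
  ^-distrib-* x y zero    = refl
  ^-distrib-* x y (suc n) = trans (cong (x * y *_) (^-distrib-* x y n))
    (solve 4 (λ x y a b → x :* y :* (a :* b) := x :* a :* (y :* b)) refl x y (x ^ n) (y ^ n))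

  1≤^ : ∀ {x} n → 1ℚ ≤ x → 1ℚ ≤ x ^ n
  1≤^     zero    1≤x = ≤-refl
  1≤^ {x} (suc n) 1≤x = subst (_≤ x * x ^ n) (*-identityˡ 1ℚ) (*-mono (≤-trans 0≤1 1≤x) 0≤1 1≤x (1≤^ n 1≤x))

  ι-^ : ∀ m n → ι (m ℕ.^ n) ≡ ι m ^ n
  ι-^ m zero    = refl
  ι-^ m (suc n) = trans (ι-* m (m ℕ.^ n)) (cong (ι m *_) (ι-^ m n))

  -- Bernoulli's inequality for (1 - ρ)⁻¹ ≥ 1 + ρ, in a form without division.
  bernoulli-inequality : ∀ {ρ} n → 0ℚ ≤ ρ → ρ ≤ 1ℚ → (1ℚ - ρ) ^ n * (1ℚ + ι n * ρ) ≤ 1ℚ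
  bernoulli-inequality {ρ} zero 0≤ρ ρ≤1 = ≤-reflexive
    (solve 1 (λ ρ → con 1ℚ :* (con 1ℚ :+ con 0ℚ :* ρ) := con 1ℚ) refl ρ)
  bernoulli-inequality {ρ} (suc n) 0≤ρ ρ≤1 = ≤-trans
    -- Going from `n` to `suc n` lowers the left-hand side by exactly σ^n ρ² (1 + n), so it never
    -- exceeds its value 1 at `n` = 0.
    (0≤q-p⇒p≤q (subst (0ℚ ≤_) identity
      (0≤* (0≤^ n 0≤σ) (0≤* (0≤* 0≤ρ 0≤ρ) (0≤+ 0≤1 (0≤ι n))))))
    (bernoulli-inequality n 0≤ρ ρ≤1)
    where
    σ : ℚ
    σ = 1ℚ - ρ
    0≤σ : 0ℚ ≤ σ
    0≤σ = p≤q⇒0≤q-p ρ≤1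
    identity : σ ^ n * (ρ * ρ * (1ℚ + ι n)) ≡ σ ^ n * (1ℚ + ι n * ρ) - σ * σ ^ n * (1ℚ + (1ℚ + ι n) * ρ)
    identity = solve 3 (λ s ρ n → s :* (ρ :* ρ :* (con 1ℚ :+ n)) :=
      s :* (con 1ℚ :+ n :* ρ) :- (con 1ℚ :- ρ) :* s :* (con 1ℚ :+ (con 1ℚ :+ n) :* ρ)) refl (σ ^ n) ρ (ι n)

  -- Finite probability spaces

  record Expectation (X : Set) : Set where
    field
      𝔼      : (X → ℚ) → ℚ
      𝔼-mono : ∀ {f g} → (∀ x → f x ≤ g x) → 𝔼 f ≤ 𝔼 g
      𝔼-+    : ∀ f g → 𝔼 (λ x → f x + g x) ≡ 𝔼 f + 𝔼 g
      𝔼-*    : ∀ c f → 𝔼 (λ x → c * f x) ≡ c * 𝔼 f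
      𝔼-1    : 𝔼 (λ _ → 1ℚ) ≡ 1ℚ

    -- Monotonicity in both directions takes the place of function extensionality.
    𝔼-cong : ∀ {f g} → (∀ x → f x ≡ g x) → 𝔼 f ≡ 𝔼 g
    𝔼-cong f≗g = ≤-antisym (𝔼-mono λ x → ≤-reflexive (f≗g x)) (𝔼-mono λ x → ≤-reflexive (sym (f≗g x)))

    𝔼-const : ∀ c → 𝔼 (λ _ → c) ≡ c
    𝔼-const c = trans (𝔼-cong λ _ → sym (*-identityʳ c))
      (trans (𝔼-* c _) (trans (cong (c *_) 𝔼-1) (*-identityʳ c)))

    𝔼-- : ∀ f g → 𝔼 (λ x → f x - g x) ≡ 𝔼 f - 𝔼 g
    𝔼-- f g = trans (𝔼-cong λ x → cong (f x +_) (neg≡-1* (g x)))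
      (trans (𝔼-+ f _) (cong (𝔼 f +_) (trans (𝔼-* (- 1ℚ) g) (sym (neg≡-1* (𝔼 g))))))
      where
      neg≡-1* : ∀ p → - p ≡ - 1ℚ * p
      neg≡-1* = solve 1 (λ p → :- p := con (- 1ℚ) :* p) refl

  open Expectation

  bernoulliᴱ : ∀ p → 0ℚ ≤ p → p ≤ 1ℚ → Expectation Bool
  bernoulliᴱ p 0≤p p≤1 .𝔼 f = p * f true + (1ℚ - p) * f false
  bernoulliᴱ p 0≤p p≤1 .𝔼-mono f≤g =
    +-mono-≤ (*-monoˡ 0≤p (f≤g true)) (*-monoˡ (p≤q⇒0≤q-p p≤1) (f≤g false))
  bernoulliᴱ p 0≤p p≤1 .𝔼-+ f g = solve 6 (λ p q a b c d →
    p :* (a :+ b) :+ q :* (c :+ d) := (p :* a :+ q :* c) :+ (p :* b :+ q :* d)) refl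
    p (1ℚ - p) (f true) (g true) (f false) (g false)
  bernoulliᴱ p 0≤p p≤1 .𝔼-* c f = solve 5 (λ p q c a b →
    p :* (c :* a) :+ q :* (c :* b) := c :* (p :* a :+ q :* b)) refl p (1ℚ - p) c (f true) (f false)
  bernoulliᴱ p 0≤p p≤1 .𝔼-1 = solve 1 (λ p → p :* con 1ℚ :+ (con 1ℚ :- p) :* con 1ℚ := con 1ℚ) refl p

  vecᴱ : ∀ {X} → Expectation X → ∀ n → Expectation (Vec X n)
  vecᴱ D zero .𝔼 f = f []
  vecᴱ D zero .𝔼-mono f≤g = f≤g []
  vecᴱ D zero .𝔼-+ f g = refl
  vecᴱ D zero .𝔼-* c f = refl
  vecᴱ D zero .𝔼-1 = refl
  vecᴱ D (suc n) .𝔼 f = 𝔼 D λ x → 𝔼 (vecᴱ D n) λ xs → f (x ∷ xs)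
  vecᴱ D (suc n) .𝔼-mono f≤g = 𝔼-mono D λ x → 𝔼-mono (vecᴱ D n) λ xs → f≤g (x ∷ xs)
  vecᴱ D (suc n) .𝔼-+ f g = trans
    (𝔼-cong D λ x → 𝔼-+ (vecᴱ D n) (λ xs → f (x ∷ xs)) (λ xs → g (x ∷ xs))) (𝔼-+ D _ _)
  vecᴱ D (suc n) .𝔼-* c f = trans (𝔼-cong D λ x → 𝔼-* (vecᴱ D n) c (λ xs → f (x ∷ xs))) (𝔼-* D c _)
  vecᴱ D (suc n) .𝔼-1 = trans (𝔼-cong D λ _ → 𝔼-1 (vecᴱ D n)) (𝔼-1 D)

  ∑ᵛ : ∀ {X : Set} {n} → (X → ℚ) → Vec X n → ℚ
  ∑ᵛ g []       = 0ℚ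
  ∑ᵛ g (x ∷ xs) = g x + ∑ᵛ g xs

  module _ {X : Set} (D : Expectation X) {g : X → ℚ} (centred : 𝔼 D g ≡ 0ℚ) where

    𝔼-∑ᵛ : ∀ n → 𝔼 (vecᴱ D n) (∑ᵛ g) ≡ 0ℚ
    𝔼-∑ᵛ zero    = refl
    𝔼-∑ᵛ (suc n) = trans (𝔼-cong D λ x → trans (𝔼-+ (vecᴱ D n) (λ _ → g x) (∑ᵛ g))
        (cong₂ _+_ (𝔼-const (vecᴱ D n) (g x)) (𝔼-∑ᵛ n)))
      (trans (𝔼-cong D λ x → +-identityʳ (g x)) centred)

    -- In the expanded square the cross term has mean zero by `𝔼-∑ᵛ`, so the variances of the
    -- independent coordinates add up.
    variance : 𝔼 D (λ x → g x * g x) ≤ 1ℚ → ∀ n → 𝔼 (vecᴱ D n) (λ xs → ∑ᵛ g xs * ∑ᵛ g xs) ≤ ι n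
    variance var≤1 zero    = ≤-refl
    variance var≤1 (suc n) = subst (_≤ 1ℚ + ι n)
      (sym (trans (𝔼-cong D step) (trans (𝔼-+ D (λ x → g x * g x) _)
        (cong (𝔼 D (λ x → g x * g x) +_) (𝔼-const D _)))))
      (+-mono-≤ var≤1 (variance var≤1 n))
      where
      E : (Vec X n → ℚ) → ℚ
      E = 𝔼 (vecᴱ D n)
      S : Vec X n → ℚ
      S = ∑ᵛ g
      step : ∀ x → E (λ xs → (g x + S xs) * (g x + S xs)) ≡ g x * g x + E (λ xs → S xs * S xs)
      step x = begin
        E (λ xs → (g x + S xs) * (g x + S xs))
          ≡⟨ 𝔼-cong (vecᴱ D n) (λ xs → solve 2 (λ a s →
               (a :+ s) :* (a :+ s) := (a :* a :+ (a :+ a) :* s) :+ s :* s) refl (g x) (S xs)) ⟩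
        E (λ xs → (g x * g x + (g x + g x) * S xs) + S xs * S xs)
          ≡⟨ 𝔼-+ (vecᴱ D n) _ _ ⟩
        E (λ xs → g x * g x + (g x + g x) * S xs) + E (λ xs → S xs * S xs)
          ≡⟨ cong (_+ E (λ xs → S xs * S xs)) (trans (𝔼-+ (vecᴱ D n) (λ _ → g x * g x) (λ xs → (g x + g x) * S xs))
               (cong₂ _+_ (𝔼-const (vecᴱ D n) (g x * g x))
                 (trans (𝔼-* (vecᴱ D n) (g x + g x) S) (trans (cong ((g x + g x) *_) (𝔼-∑ᵛ n)) (*-zeroʳ (g x + g x)))))) ⟩
        (g x * g x + 0ℚ) + E (λ xs → S xs * S xs)
          ≡⟨ cong (_+ E (λ xs → S xs * S xs)) (+-identityʳ (g x * g x)) ⟩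
        g x * g x + E (λ xs → S xs * S xs) ∎
        where open ≡-Reasoning

  indicator : ∀ {P : Set} → Dec P → ℚ
  indicator (yes _) = 1ℚ
  indicator (no _)  = 0ℚ

  0≤indicator : ∀ {P : Set} (P? : Dec P) → 0ℚ ≤ indicator P?
  0≤indicator (yes _) = 0≤1
  0≤indicator (no _)  = ≤-refl

  indicator-≤1 : ∀ {P : Set} (P? : Dec P) → indicator P? ≤ 1ℚ
  indicator-≤1 (yes _) = ≤-refl
  indicator-≤1 (no _)  = 0≤1

  markov : ∀ {X} (D : Expectation X) {P : X → Set} (P? : ∀ x → Dec (P x)) {f : X → ℚ} {s δ} →
           0ℚ < s → (∀ x → 0ℚ ≤ f x) → (∀ x → P x → s ≤ f x) → 𝔼 D f ≤ s * δ →
           𝔼 D (λ x → indicator (P? x)) ≤ δ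
  markov D P? {f} {s} {δ} 0<s 0≤f s≤f Ef≤sδ = *-cancelˡ 0<s
    (≤-trans (subst (_≤ 𝔼 D f) (𝔼-* D s _) (𝔼-mono D bound)) Ef≤sδ)
    where
    bound : ∀ x → s * indicator (P? x) ≤ f x
    bound x with P? x
    ... | yes p = subst (_≤ f x) (sym (*-identityʳ s)) (s≤f x p)
    ... | no _  = subst (_≤ f x) (sym (*-zeroʳ s)) (0≤f x)

  -- Random graphs

  ∑ˡ : ∀ {X : Set} → (X → ℚ) → List X → ℚ
  ∑ˡ f []       = 0ℚ
  ∑ˡ f (x ∷ xs) = f x + ∑ˡ f xs

  ∑ˡ-cong : ∀ {X : Set} {f g : X → ℚ} → (∀ x → f x ≡ g x) → ∀ xs → ∑ˡ f xs ≡ ∑ˡ g xs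
  ∑ˡ-cong f≗g []       = refl
  ∑ˡ-cong f≗g (x ∷ xs) = cong₂ _+_ (f≗g x) (∑ˡ-cong f≗g xs)

  ∑ˡ-++ : ∀ {X : Set} (f : X → ℚ) xs ys → ∑ˡ f (xs ++ ys) ≡ ∑ˡ f xs + ∑ˡ f ys
  ∑ˡ-++ f []       ys = sym (+-identityˡ _)
  ∑ˡ-++ f (x ∷ xs) ys = trans (cong (f x +_) (∑ˡ-++ f xs ys)) (sym (+-assoc (f x) _ _))

  ∑ˡ-map : ∀ {X Y : Set} (f : Y → ℚ) (g : X → Y) xs → ∑ˡ f (List.map g xs) ≡ ∑ˡ (f ∘ g) xs
  ∑ˡ-map f g []       = refl
  ∑ˡ-map f g (x ∷ xs) = cong (f (g x) +_) (∑ˡ-map f g xs)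

  ∑ˡ-* : ∀ {X : Set} c (f : X → ℚ) xs → ∑ˡ (λ x → c * f x) xs ≡ c * ∑ˡ f xs
  ∑ˡ-* c f []       = sym (*-zeroʳ c)
  ∑ˡ-* c f (x ∷ xs) = trans (cong (c * f x +_) (∑ˡ-* c f xs)) (sym (*-distribˡ-+ c (f x) _))

  ∑ˡ-cartesianProductWith : ∀ {X Y Z : Set} (h : Z → ℚ) (f : X → Y → Z) xs ys →
    ∑ˡ h (List.cartesianProductWith f xs ys) ≡ ∑ˡ (λ x → ∑ˡ (λ y → h (f x y)) ys) xs
  ∑ˡ-cartesianProductWith h f []       ys = refl
  ∑ˡ-cartesianProductWith h f (x ∷ xs) ys = trans (∑ˡ-++ h (List.map (f x) ys) _)
    (cong₂ _+_ (∑ˡ-map h (f x) ys) (∑ˡ-cartesianProductWith h f xs ys))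

  ∏ᵛ : ∀ {X : Set} {n} → (X → ℚ) → Vec X n → ℚ
  ∏ᵛ w []       = 1ℚ
  ∏ᵛ w (x ∷ xs) = w x * ∏ᵛ w xs

  -- Links the two forms of a product measure: the iterated expectation, convenient for induction,
  -- and the weighted sum over an enumeration in which `ℙ` is defined.
  vecᴱ-∑ : ∀ {X} (D : Expectation X) (w : X → ℚ) (L : List X) →
    (∀ f → 𝔼 D f ≡ ∑ˡ (λ x → w x * f x) L) →
    ∀ n f → 𝔼 (vecᴱ D n) f ≡ ∑ˡ (λ xs → ∏ᵛ w xs * f xs) (vectors L n)
  vecᴱ-∑ D w L D-∑ zero    f = sym (trans (+-identityʳ _) (*-identityˡ (f [])))
  vecᴱ-∑ D w L D-∑ (suc n) f = begin
    𝔼 D (λ x → 𝔼 (vecᴱ D n) λ xs → f (x ∷ xs))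
      ≡⟨ D-∑ _ ⟩
    ∑ˡ (λ x → w x * 𝔼 (vecᴱ D n) (λ xs → f (x ∷ xs))) L
      ≡⟨ ∑ˡ-cong (λ x → trans (cong (w x *_) (vecᴱ-∑ D w L D-∑ n (λ xs → f (x ∷ xs))))
           (trans (sym (∑ˡ-* (w x) _ (vectors L n)))
             (∑ˡ-cong (λ xs → sym (*-assoc (w x) (∏ᵛ w xs) (f (x ∷ xs)))) (vectors L n)))) L ⟩
    ∑ˡ (λ x → ∑ˡ (λ xs → w x * ∏ᵛ w xs * f (x ∷ xs)) (vectors L n)) L
      ≡⟨ ∑ˡ-cartesianProductWith (λ xs → ∏ᵛ w xs * f xs) _∷_ L (vectors L n) ⟨
    ∑ˡ (λ xs → ∏ᵛ w xs * f xs) (vectors L (suc n)) ∎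
    where open ≡-Reasoning

  ∏-seq : ∀ {X : Set} {n} (h : X → ℝ) (xs : Vec X n) k → ∏ (Vec.map h xs) .seq k ≡ ∏ᵛ (λ x → h x .seq k) xs
  ∏-seq h []       k = refl
  ∏-seq h (x ∷ xs) k = cong (h x .seq k *_) (∏-seq h xs k)

  ∏ᵛ-cong : ∀ {X : Set} {n} {v w : X → ℚ} → (∀ x → v x ≡ w x) → ∀ (xs : Vec X n) → ∏ᵛ v xs ≡ ∏ᵛ w xs
  ∏ᵛ-cong v≗w []       = refl
  ∏ᵛ-cong v≗w (x ∷ xs) = cong₂ _*_ (v≗w x) (∏ᵛ-cong v≗w xs)

  ∑-filter-seq : ∀ {X : Set} (h : X → ℝ) {P : Pred X 0ℓ} (P? : Decidable P) xs k →
    ∑ (List.map h (List.filter P? xs)) .seq k ≡ ∑ˡ (λ x → h x .seq k * indicator (P? x)) xs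
  ∑-filter-seq h P? []       k = refl
  ∑-filter-seq h P? (x ∷ xs) k with P? x
  ... | yes _ = cong₂ _+_ (sym (*-identityʳ (h x .seq k))) (∑-filter-seq h P? xs k)
  ... | no _  = trans (∑-filter-seq h P? xs k)
                  (sym (trans (cong (_+ ∑ˡ (λ x → h x .seq k * indicator (P? x)) xs) (*-zeroʳ (h x .seq k)))
                    (+-identityˡ _)))

  graphᴱ : ∀ p → 0ℚ ≤ p → p ≤ 1ℚ → ∀ nA nB → Expectation (Graph nA nB)
  graphᴱ p 0≤p p≤1 nA nB = vecᴱ (vecᴱ (bernoulliᴱ p 0≤p p≤1) nB) nA

  -- Real addition and multiplication act termwise, so the `k`-th term of the real number `ℙ` is an
  -- exact probability at the rational `p .seq k`. The two bounds on that term hold only for late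
  -- `k`, hence they are hypotheses here.
  ℙ-seq : ∀ nA nB p {E : Pred (Graph nA nB) 0ℓ} (E? : Decidable E) k
    (0≤p : 0ℚ ≤ p .seq k) (p≤1 : p .seq k ≤ 1ℚ) →
    ℙ nA nB p E? .seq k ≡ 𝔼 (graphᴱ (p .seq k) 0≤p p≤1 nA nB) (λ G → indicator (E? G))
  ℙ-seq nA nB p E? k 0≤p p≤1 = trans (∑-filter-seq (weight p) E? (graphs nA nB) k)
    (trans (∑ˡ-cong (λ G → cong (_* indicator (E? G))
        (trans (∏-seq _ G k) (∏ᵛ-cong (λ N → ∏-seq (bernoulli p) N k) G))) (graphs nA nB))
      (sym (vecᴱ-∑ (vecᴱ B nB) _ _ (vecᴱ-∑ B _ (true ∷ false ∷ []) B-∑ nB) nA (λ G → indicator (E? G)))))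
    where
    B : Expectation Bool
    B = bernoulliᴱ (p .seq k) 0≤p p≤1
    B-∑ : ∀ f → 𝔼 B f ≡ ∑ˡ (λ b → bernoulli p b .seq k * f b) (true ∷ false ∷ [])
    B-∑ f = cong (p .seq k * f true +_) (sym (+-identityʳ _))

  -- Independence of cells, by redrawing one of them

  Resampling : ∀ {X : Set} → Expectation X → ℚ → (Bool → X → X) → Set
  Resampling D p r = ∀ f → 𝔼 D f ≡ p * 𝔼 D (f ∘ r true) + (1ℚ - p) * 𝔼 D (f ∘ r false)

  vecᴱ-resampling : ∀ {X} (D : Expectation X) p r → Resampling D p r →
    ∀ {n} (i : Fin n) → Resampling (vecᴱ D n) p (λ v xs → updateAt xs i (r v))
  vecᴱ-resampling D p r resample zero f = resample _
  vecᴱ-resampling D p r resample {suc n} (suc i) f = trans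
    (𝔼-cong D λ x → vecᴱ-resampling D p r resample i (λ xs → f (x ∷ xs)))
    (trans (𝔼-+ D _ _) (cong₂ _+_ (𝔼-* D p _) (𝔼-* D (1ℚ - p) _)))

  Cell : ℕ → ℕ → Set
  Cell nA nB = Fin nA × Fin nB

  module _ {nA nB : ℕ} where

    set : Cell nA nB → Bool → Graph nA nB → Graph nA nB
    set (a , b) v G = updateAt G a λ N → updateAt N b (const v)

    bit : Cell nA nB → Graph nA nB → Bool
    bit (a , b) G = lookup (lookup G a) b

    bit-set : ∀ x v G → bit x (set x v G) ≡ v
    bit-set (a , b) v G = trans (cong (λ N → lookup N b) (Vec.lookup∘updateAt a G))
      (Vec.lookup∘updateAt b (lookup G a))

    bit-set-≢ : ∀ {x y} v G → x ≢ y → bit y (set x v G) ≡ bit y G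
    bit-set-≢ {a , b} {a′ , b′} v G x≢y with a′ Fin.≟ a
    ... | no a′≢a  = cong (λ N → lookup N b′) (Vec.lookup∘updateAt′ a′ a a′≢a G)
    ... | yes refl = trans (cong (λ N → lookup N b′) (Vec.lookup∘updateAt a G))
                       (Vec.lookup∘updateAt′ b′ b (λ { refl → x≢y refl }) (lookup G a))

    absent : Bool → ℚ
    absent true  = 0ℚ
    absent false = 1ℚ

    -- The indicator that no cell of the list is an edge, written with one factor per cell so that
    -- expectations can be computed cell by cell; `indicator-good` identifies it with the decidable
    -- event.
    vacant : List (Cell nA nB) → Graph nA nB → ℚ
    vacant []      G = 1ℚ
    vacant (x ∷ L) G = absent (bit x G) * vacant L G

    noneVacant : List (List (Cell nA nB)) → Graph nA nB → ℚ
    noneVacant []       G = 1ℚ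
    noneVacant (L ∷ Ls) G = (1ℚ - vacant L G) * noneVacant Ls G

    Ignores : (Graph nA nB → ℚ) → Cell nA nB → Set
    Ignores g x = ∀ v G → g (set x v G) ≡ g G

    vacant-ignores : ∀ {x} L → x ∉ L → Ignores (vacant L) x
    vacant-ignores []      x∉L v G = refl
    vacant-ignores (y ∷ L) x∉L v G = cong₂ _*_
      (cong absent (bit-set-≢ v G (x∉L ∘ here))) (vacant-ignores L (x∉L ∘ there) v G)

    noneVacant-ignores : ∀ {x} Ls → All (x ∉_) Ls → Ignores (noneVacant Ls) x
    noneVacant-ignores []       []             v G = refl
    noneVacant-ignores (L ∷ Ls) (x∉L ∷ x∉Ls) v G =
      cong₂ _*_ (cong (λ s → 1ℚ - s) (vacant-ignores L x∉L v G)) (noneVacant-ignores Ls x∉Ls v G)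

    module _ (p : ℚ) (0≤p : 0ℚ ≤ p) (p≤1 : p ≤ 1ℚ) where

      private
        D : Expectation (Graph nA nB)
        D = graphᴱ p 0≤p p≤1 nA nB
        q : ℚ
        q = 1ℚ - p

      -- Says that the cell `x` is an edge with probability `p` independently of all others. It can
      -- be applied to the cells in any order, although `graphᴱ` integrates them in a fixed one.
      graphᴱ-resampling : ∀ x → Resampling D p (set x)
      graphᴱ-resampling (a , b) = vecᴱ-resampling (vecᴱ B nB) p (λ v N → updateAt N b (const v))
        (vecᴱ-resampling B p const B-resampling b) a
        where
        B : Expectation Bool
        B = bernoulliᴱ p 0≤p p≤1
        B-resampling : Resampling B p const
        B-resampling f = sym (cong₂ (λ s t → p * s + q * t) (𝔼-const B (f true)) (𝔼-const B (f false)))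

      -- Redraw `x`: if it becomes an edge the product vanishes, and otherwise, with probability
      -- `q`, only `g` remains.
      𝔼-absent : ∀ x {g} → Ignores g x → 𝔼 D (λ G → absent (bit x G) * g G) ≡ q * 𝔼 D g
      𝔼-absent x {g} g-ignores = begin
        𝔼 D (λ G → absent (bit x G) * g G)
          ≡⟨ graphᴱ-resampling x _ ⟩
        p * 𝔼 D (λ G → absent (bit x (set x true G)) * g (set x true G)) +
        q * 𝔼 D (λ G → absent (bit x (set x false G)) * g (set x false G))
          ≡⟨ cong₂ (λ s t → p * s + q * t)
               (trans (𝔼-cong D λ G → trans (cong (λ b → absent b * g (set x true G)) (bit-set x true G))
                  (*-zeroˡ (g (set x true G)))) (𝔼-const D 0ℚ))
               (𝔼-cong D λ G → trans (cong₂ (λ b → absent b *_) (bit-set x false G) (g-ignores false G))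
                  (*-identityˡ (g G))) ⟩
        p * 0ℚ + q * 𝔼 D g
          ≡⟨ cong (_+ q * 𝔼 D g) (*-zeroʳ p) ⟩
        0ℚ + q * 𝔼 D g
          ≡⟨ +-identityˡ (q * 𝔼 D g) ⟩
        q * 𝔼 D g ∎
        where open ≡-Reasoning

      𝔼-vacant-* : ∀ L {g} → Unique L → All (Ignores g) L →
                   𝔼 D (λ G → vacant L G * g G) ≡ q ^ length L * 𝔼 D g
      𝔼-vacant-* []      {g} []           []             =
        trans (𝔼-cong D λ G → *-identityˡ (g G)) (sym (*-identityˡ (𝔼 D g)))
      𝔼-vacant-* (x ∷ L) {g} (x∉L ∷ L!) (g-ignores-x ∷ g-ignores-L) = begin
        𝔼 D (λ G → absent (bit x G) * vacant L G * g G)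
          ≡⟨ 𝔼-cong D (λ G → *-assoc (absent (bit x G)) (vacant L G) (g G)) ⟩
        𝔼 D (λ G → absent (bit x G) * (vacant L G * g G))
          ≡⟨ 𝔼-absent x (λ v G → cong₂ _*_
               (vacant-ignores L (λ x∈L → All.lookup x∉L x∈L refl) v G) (g-ignores-x v G)) ⟩
        q * 𝔼 D (λ G → vacant L G * g G)
          ≡⟨ cong (q *_) (𝔼-vacant-* L L! g-ignores-L) ⟩
        q * (q ^ length L * 𝔼 D g)
          ≡⟨ *-assoc q (q ^ length L) (𝔼 D g) ⟨
        q * q ^ length L * 𝔼 D g ∎
        where open ≡-Reasoning

      𝔼-vacant : ∀ L → Unique L → 𝔼 D (vacant L) ≡ q ^ length L
      𝔼-vacant L L! = trans (𝔼-cong D λ G → sym (*-identityʳ (vacant L G)))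
        (trans (𝔼-vacant-* L L! (All.universal (λ _ _ _ → refl) L))
          (trans (cong (q ^ length L *_) (𝔼-1 D)) (*-identityʳ (q ^ length L))))

      -- Multiply out the first factor. By disjointness the remaining product ignores every cell of
      -- `L`, so `vacant L` contributes the factor `q ^ ℓ` and the two terms recombine.
      𝔼-noneVacant : ∀ ℓ Ls → All (λ L → length L ≡ ℓ) Ls → All Unique Ls → AllPairs Disjoint Ls →
                     𝔼 D (noneVacant Ls) ≡ (1ℚ - q ^ ℓ) ^ length Ls
      𝔼-noneVacant ℓ []       []            []        []        = 𝔼-1 D
      𝔼-noneVacant ℓ (L ∷ Ls) (refl ∷ len) (L! ∷ Ls!) (L# ∷ Ls#) = begin
        𝔼 D (λ G → (1ℚ - vacant L G) * noneVacant Ls G)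
          ≡⟨ 𝔼-cong D (λ G → expand (vacant L G) (noneVacant Ls G)) ⟩
        𝔼 D (λ G → noneVacant Ls G - vacant L G * noneVacant Ls G)
          ≡⟨ 𝔼-- D _ _ ⟩
        𝔼 D (noneVacant Ls) - 𝔼 D (λ G → vacant L G * noneVacant Ls G)
          ≡⟨ cong (λ t → 𝔼 D (noneVacant Ls) - t) (𝔼-vacant-* L L! (All.tabulate λ x∈L →
               noneVacant-ignores Ls (All.map (λ disjoint x∈L′ → disjoint (x∈L , x∈L′)) L#))) ⟩
        𝔼 D (noneVacant Ls) - q ^ ℓ * 𝔼 D (noneVacant Ls)
          ≡⟨ expand (q ^ ℓ) (𝔼 D (noneVacant Ls)) ⟨
        (1ℚ - q ^ ℓ) * 𝔼 D (noneVacant Ls)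
          ≡⟨ cong ((1ℚ - q ^ ℓ) *_) (𝔼-noneVacant ℓ Ls len Ls! Ls#) ⟩
        (1ℚ - q ^ ℓ) * (1ℚ - q ^ ℓ) ^ length Ls ∎
        where
        open ≡-Reasoning
        expand : ∀ s t → (1ℚ - s) * t ≡ t - s * t
        expand = solve 2 (λ s t → (con 1ℚ :- s) :* t := t :- s :* t) refl

  -- Colourings from covers by induced matchings

  []=-irrelevant : ∀ {X : Set} {n} {xs : Vec X n} {i x} (e f : xs Vec.[ i ]= x) → e ≡ f
  []=-irrelevant Vec.here      Vec.here      = refl
  []=-irrelevant (Vec.there e) (Vec.there f) = cong Vec.there ([]=-irrelevant e f)

  Good : ∀ {nA nB} → Graph nA nB → List (Cell nA nB) → Set
  Good G L = All (λ x → bit x G ≡ false) L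

  module _ {nA nB : ℕ} (G : Graph nA nB) where

    Independent : (Cell nA nB → Set) → Set
    Independent P = ∀ e f → P (proj₁ e) → P (proj₁ f) → e ≢ f → ¬ (ShareVertex G e f ⊎ JoinedByEdge G e f)

    -- The colour of an edge is the position of the class that `cover` returns for it. Classes may
    -- overlap: two edges of the same colour lie together in the class at that position, which is
    -- all that independence asks for.
    χ′ₛ-≤-cover : (Ps : List (Cell nA nB → Set)) → All Independent Ps →
                  (∀ e → Any (λ P → P (proj₁ e)) Ps) → χ′ₛ G ℕ.≤ length Ps
    χ′ₛ-≤-cover Ps independent cover = proj₂ (proj₂ (minimumColours G)) (length Ps) record
      { colour = λ e → Any.index (cover e)
      ; strong = λ e f e≢f near same → All.lookup independent (∈.∈-lookup (Any.index (cover e))) e f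
          (Any.lookup-index (cover e))
          (subst (λ i → List.lookup Ps i (proj₁ f)) (sym same) (Any.lookup-index (cover f)))
          e≢f near
      }

    edge-≡ : (e f : Edge G) → proj₁ e ≡ proj₁ f → e ≡ f
    edge-≡ (x , e) (.x , f) refl = cong (x ,_) ([]=-irrelevant e f)

    adj⇒bit : ∀ {a b} → Adj G a b → bit (a , b) G ≡ true
    adj⇒bit = Vec.[]=⇒lookup

  -- Arithmetic modulo `k`

  module _ {k′ : ℕ} where

    private
      k : ℕ
      k = suc k′

    infixl 6 _⊞_ _⊟_
    _⊞_ _⊟_ : Fin k → Fin k → Fin k
    i ⊞ d = fromℕ< (ℕ.m%n<n (toℕ i ℕ.+ toℕ d) k)
    i ⊟ d = fromℕ< (ℕ.m%n<n (toℕ i ℕ.+ (k ℕ.∸ toℕ d)) k)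

    private
      %-absorbˡ : ∀ m n → (m ℕ.% k ℕ.+ n) ℕ.% k ≡ (m ℕ.+ n) ℕ.% k
      %-absorbˡ m n = trans (ℕ.%-distribˡ-+ (m ℕ.% k) n k)
        (trans (cong (λ t → (t ℕ.+ n ℕ.% k) ℕ.% k) (ℕ.m%n%n≡m%n m k)) (sym (ℕ.%-distribˡ-+ m n k)))

      -- Both cancellation laws are instances, with `toℕ d` and `k ℕ.∸ toℕ d` as `m` and `n` in
      -- either order.
      round-trip : ∀ (i : Fin k) m n → m ℕ.+ n ≡ k → ((toℕ i ℕ.+ m) ℕ.% k ℕ.+ n) ℕ.% k ≡ toℕ i
      round-trip i m n m+n≡k = trans (%-absorbˡ (toℕ i ℕ.+ m) n)
        (trans (cong (ℕ._% k) (trans (ℕ.+-assoc (toℕ i) m n) (cong (toℕ i ℕ.+_) m+n≡k)))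
          (trans (ℕ.[m+n]%n≡m%n (toℕ i) k) (ℕ.m<n⇒m%n≡m (Fin.toℕ<n i))))

      toℕ-⊞ : ∀ i d → toℕ (i ⊞ d) ≡ (toℕ i ℕ.+ toℕ d) ℕ.% k
      toℕ-⊞ i d = Fin.toℕ-fromℕ< _

      toℕ-⊟ : ∀ i d → toℕ (i ⊟ d) ≡ (toℕ i ℕ.+ (k ℕ.∸ toℕ d)) ℕ.% k
      toℕ-⊟ i d = Fin.toℕ-fromℕ< _

    ⊞-⊟ : ∀ i d → i ⊞ d ⊟ d ≡ i
    ⊞-⊟ i d = Fin.toℕ-injective (trans (toℕ-⊟ (i ⊞ d) d)
      (trans (cong (λ m → (m ℕ.+ (k ℕ.∸ toℕ d)) ℕ.% k) (toℕ-⊞ i d))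
        (round-trip i (toℕ d) (k ℕ.∸ toℕ d) (ℕ.m+[n∸m]≡n (ℕ.<⇒≤ (Fin.toℕ<n d))))))

    ⊟-⊞ : ∀ i d → i ⊟ d ⊞ d ≡ i
    ⊟-⊞ i d = Fin.toℕ-injective (trans (toℕ-⊞ (i ⊟ d) d)
      (trans (cong (λ m → (m ℕ.+ toℕ d) ℕ.% k) (toℕ-⊟ i d))
        (round-trip i (k ℕ.∸ toℕ d) (toℕ d) (ℕ.m∸n+n≡m (ℕ.<⇒≤ (Fin.toℕ<n d))))))

    ⊞-comm : ∀ i d → i ⊞ d ≡ d ⊞ i
    ⊞-comm i d = Fin.toℕ-injective (trans (toℕ-⊞ i d)
      (trans (cong (ℕ._% k) (ℕ.+-comm (toℕ i) (toℕ d))) (sym (toℕ-⊞ d i))))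

    ⊞-cancelʳ : ∀ {i j} d → i ⊞ d ≡ j ⊞ d → i ≡ j
    ⊞-cancelʳ {i} {j} d eq = trans (sym (⊞-⊟ i d)) (trans (cong (_⊟ d) eq) (⊞-⊟ j d))

    ⊞-solve : ∀ i j → i ⊞ (j ⊟ i) ≡ j
    ⊞-solve i j = trans (⊞-comm i (j ⊟ i)) (⊟-⊞ j i)

  -- Base-`k` digits and enumerations

  encode : ∀ {k n} → Vec (Fin k) n → Fin (k ℕ.^ n)
  encode []       = zero
  encode (x ∷ xs) = combine x (encode xs)

  encode-injective : ∀ {k n} (xs ys : Vec (Fin k) n) → encode xs ≡ encode ys → xs ≡ ys
  encode-injective []       []       eq = refl
  encode-injective (x ∷ xs) (y ∷ ys) eq with x≡y , eq′ ← Fin.combine-injective x (encode xs) y (encode ys) eq =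
    cong₂ _∷_ x≡y (encode-injective xs ys eq′)

  encode-surjective : ∀ {k} n (i : Fin (k ℕ.^ n)) → ∃[ xs ] encode {k} {n} xs ≡ i
  encode-surjective         zero    zero = [] , refl
  encode-surjective {k} (suc n) i =
    let x , j    = remQuot {k} (k ℕ.^ n) i
        xs , eq  = encode-surjective {k} n j
    in x ∷ xs , trans (cong (combine x) eq) (Fin.combine-remQuot {k} (k ℕ.^ n) i)

  ∈-vectors : ∀ {X : Set} {L : List X} → (∀ x → x ∈ L) → ∀ {n} (xs : Vec X n) → xs ∈ vectors L n
  ∈-vectors ∈L []       = here refl
  ∈-vectors ∈L (x ∷ xs) = ∈.∈-cartesianProductWith⁺ _∷_ (∈L x) (∈-vectors ∈L xs)

  length-cartesianProductWith : ∀ {X Y Z : Set} (f : X → Y → Z) xs ys →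
    length (cartesianProductWith f xs ys) ≡ length xs ℕ.* length ys
  length-cartesianProductWith f []       ys = refl
  length-cartesianProductWith f (x ∷ xs) ys = trans (List.length-++ (List.map (f x) ys))
    (cong₂ ℕ._+_ (List.length-map (f x) ys) (length-cartesianProductWith f xs ys))

  length-vectors : ∀ {X : Set} (L : List X) n → length (vectors L n) ≡ length L ℕ.^ n
  length-vectors L zero    = refl
  length-vectors L (suc n) = trans (length-cartesianProductWith _∷_ L (vectors L n))
    (cong (length L ℕ.*_) (length-vectors L n))

  length-allFin : ∀ n → length (allFin n) ≡ n
  length-allFin n = List.length-tabulate (λ i → i)

  offDiagonal : ∀ k → List (Fin k × Fin k)
  offDiagonal k = List.filter (λ (i , j) → ¬? (i Fin.≟ j)) (cartesianProduct (allFin k) (allFin k))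

  offDiagonal-unique : ∀ k → Unique (offDiagonal k)
  offDiagonal-unique k = Unique.filter⁺ _ (Unique.cartesianProduct⁺ (Unique.allFin⁺ k) (Unique.allFin⁺ k))

  ∈-offDiagonal⁺ : ∀ {k} {i j : Fin k} → i ≢ j → (i , j) ∈ offDiagonal k
  ∈-offDiagonal⁺ {i = i} {j} i≢j = ∈.∈-filter⁺ _ (∈.∈-cartesianProduct⁺ (∈.∈-allFin i) (∈.∈-allFin j)) i≢j

  ∈-offDiagonal⁻ : ∀ {k} {i j : Fin k} → (i , j) ∈ offDiagonal k → i ≢ j
  ∈-offDiagonal⁻ {k} ij∈ = proj₂ (∈.∈-filter⁻ (λ (i , j) → ¬? (i Fin.≟ j)) {xs = cartesianProduct (allFin k) (allFin k)} ij∈)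

  -- Geometry of blocks, lines and chunks

  module Blocks (k′ T′ : ℕ) where

    k T M : ℕ
    k = suc k′
    T = suc T′
    M = k ℕ.^ T

    -- A site is a vertex given by its block and its coordinates inside the block. A line omits one
    -- coordinate; which one is passed separately as a direction, so that lines in all directions
    -- share one type.
    Site Line : ℕ → Set
    Site u = Fin u × Vec (Fin k) T
    Line u = Fin u × Vec (Fin k) T′

    sites : ∀ u → List (Site u)
    sites u = cartesianProduct (allFin u) (vectors (allFin k) T)

    lines : ∀ u → List (Line u)
    lines u = cartesianProduct (allFin u) (vectors (allFin k) T′)

    ∈-sites : ∀ {u} (s : Site u) → s ∈ sites u
    ∈-sites (x , α) = ∈.∈-cartesianProduct⁺ (∈.∈-allFin x) (∈-vectors ∈.∈-allFin α)

    ∈-lines : ∀ {u} (l : Line u) → l ∈ lines u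
    ∈-lines (x , α) = ∈.∈-cartesianProduct⁺ (∈.∈-allFin x) (∈-vectors ∈.∈-allFin α)

    length-sites : ∀ u → length (sites u) ≡ u ℕ.* k ℕ.^ T
    length-sites u = trans (length-cartesianProductWith _,_ (allFin u) _)
      (cong₂ ℕ._*_ (length-allFin u) (trans (length-vectors (allFin k) T) (cong (ℕ._^ T) (length-allFin k))))

    length-lines : ∀ u → length (lines u) ≡ u ℕ.* k ℕ.^ T′
    length-lines u = trans (length-cartesianProductWith _,_ (allFin u) _)
      (cong₂ ℕ._*_ (length-allFin u) (trans (length-vectors (allFin k) T′) (cong (ℕ._^ T′) (length-allFin k))))

    coord : ∀ {u} → Fin T → Site u → Fin k
    coord t (_ , α) = lookup α t

    point : ∀ {u} → Fin T → Line u → Fin k → Site u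
    point t (x , α) j = x , insertAt α t j

    lineOf : ∀ {u} → Fin T → Site u → Line u
    lineOf t (x , α) = x , removeAt α t

    point-lineOf : ∀ {u} t (s : Site u) → point t (lineOf t s) (coord t s) ≡ s
    point-lineOf t (x , α) = cong (x ,_) (Vec.insertAt-removeAt α t)

    coord-point : ∀ {u} t (l : Line u) j → coord t (point t l j) ≡ j
    coord-point t (x , α) j = Vec.insertAt-lookup α t j

    -- Moving in direction `t₁` fixes all other coordinates. The disjointness of chunks in different
    -- directions, and with it the independence of the rounds, rests on this.
    coord-point-≢ : ∀ {u} {t t₁} (s : Site u) j → t₁ ≢ t → coord t (point t₁ (lineOf t₁ s) j) ≡ coord t s
    coord-point-≢ {t = t} {t₁} (x , α) j t₁≢t = begin
      lookup (insertAt (removeAt α t₁) t₁ j) t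
        ≡⟨ cong (lookup (insertAt (removeAt α t₁) t₁ j)) (Fin.punchIn-punchOut t₁≢t) ⟨
      lookup (insertAt (removeAt α t₁) t₁ j) (punchIn t₁ (punchOut t₁≢t))
        ≡⟨ Vec.insertAt-punchIn (removeAt α t₁) t₁ j (punchOut t₁≢t) ⟩
      lookup (removeAt α t₁) (punchOut t₁≢t)
        ≡⟨ Vec.removeAt-punchOut α t₁≢t ⟩
      lookup α t ∎
      where open ≡-Reasoning

    -- The `r` vertices outside all blocks are numbered first, and the sites follow.
    vertex : ∀ r {u} → Site u → Fin (r ℕ.+ u ℕ.* M)
    vertex r (x , α) = r ↑ʳ combine x (encode α)

    vertex-injective : ∀ r {u} (s s₁ : Site u) → vertex r s ≡ vertex r s₁ → s ≡ s₁
    vertex-injective r (x , α) (y , β) eq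
      with x≡y , eq′ ← Fin.combine-injective x (encode α) y (encode β) (Fin.↑ʳ-injective r _ _ eq) =
      cong₂ _,_ x≡y (encode-injective α β eq′)

    coord-vertex : ∀ r {u} t (l : Line u) i (s : Site u) → vertex r (point t l i) ≡ vertex r s → i ≡ coord t s
    coord-vertex r t l i s eq = trans (sym (coord-point t l i)) (cong (coord t) (vertex-injective r (point t l i) s eq))

    remainder : ∀ r u → List (Fin (r ℕ.+ u ℕ.* M))
    remainder r u = List.map (_↑ˡ (u ℕ.* M)) (allFin r)

    length-remainder : ∀ r u → length (remainder r u) ≡ r
    length-remainder r u = trans (List.length-map _ (allFin r)) (length-allFin r)

    locate : ∀ r u a → a ∈ remainder r u ⊎ ∃[ s ] vertex r {u} s ≡ a
    locate r u a with splitAt r a in eq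
    ... | inj₁ i = inj₁ (subst (_∈ remainder r u) (Fin.splitAt⁻¹-↑ˡ eq)
                     (∈.∈-map⁺ (_↑ˡ (u ℕ.* M)) (∈.∈-allFin i)))
    ... | inj₂ i =
      let x , j   = remQuot {u} M i
          α , eq′ = encode-surjective {k} T j
      in inj₂ ((x , α) , trans (cong (λ m → r ↑ʳ combine x m) eq′)
           (trans (cong (r ↑ʳ_) (Fin.combine-remQuot {u} M i)) (Fin.splitAt⁻¹-↑ʳ {r} eq)))

    module Grid (rA uA rB uB : ℕ) where

      nA nB : ℕ
      nA = rA ℕ.+ uA ℕ.* M
      nB = rB ℕ.+ uB ℕ.* M

      -- (t , l , m , d) stands for the matching that joins, for each i, the point i of
      -- l to the point i ⊞ d of m, where l and m are lines in direction t.
      Chunk : Set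
      Chunk = Fin T × Line uA × Line uB × Fin k

      chunks : List Chunk
      chunks = cartesianProduct (allFin T) (cartesianProduct (lines uA) (cartesianProduct (lines uB) (allFin k)))

      ∈-chunks : ∀ c → c ∈ chunks
      ∈-chunks (t , l , m , d) = ∈.∈-cartesianProduct⁺ (∈.∈-allFin t) (∈.∈-cartesianProduct⁺ (∈-lines l)
        (∈.∈-cartesianProduct⁺ (∈-lines m) (∈.∈-allFin d)))

      length-chunks : length chunks ≡ T ℕ.* (uA ℕ.* k ℕ.^ T′ ℕ.* (uB ℕ.* k ℕ.^ T′ ℕ.* k))
      length-chunks =
        trans (length-cartesianProductWith _,_ (allFin T) (cartesianProduct (lines uA) mds)) (cong₂ ℕ._*_ (length-allFin T)
        (trans (length-cartesianProductWith _,_ (lines uA) mds) (cong₂ ℕ._*_ (length-lines uA)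
        (trans (length-cartesianProductWith _,_ (lines uB) (allFin k)) (cong₂ ℕ._*_ (length-lines uB) (length-allFin k))))))
        where
        mds : List (Line uB × Fin k)
        mds = cartesianProduct (lines uB) (allFin k)

      -- The row of the `i`-th and the column of the `j`-th cell of the matching. The matching
      -- itself is the diagonal, and any edge joining two of its cells is an off-diagonal cell.
      cellAt : Chunk → Fin k → Fin k → Cell nA nB
      cellAt (t , l , m , d) i j = vertex rA (point t l i) , vertex rB (point t m (j ⊞ d))

      row-injective : ∀ c {i j i₁ j₁} → proj₁ (cellAt c i j) ≡ proj₁ (cellAt c i₁ j₁) → i ≡ i₁
      row-injective (t , l , m , d) {i} {i₁ = i₁} eq =
        trans (coord-vertex rA t l i (point t l i₁) eq) (coord-point t l i₁)

      column-injective : ∀ c {i j i₁ j₁} → proj₂ (cellAt c i j) ≡ proj₂ (cellAt c i₁ j₁) → j ≡ j₁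
      column-injective (t , l , m , d) {j = j} {j₁ = j₁} eq =
        ⊞-cancelʳ d (trans (coord-vertex rB t m (j ⊞ d) (point t m (j₁ ⊞ d)) eq) (coord-point t m (j₁ ⊞ d)))

      chunkCells : Chunk → Cell nA nB → Set
      chunkCells c x = ∃[ i ] x ≡ cellAt c i i

      crossings : Chunk → List (Cell nA nB)
      crossings c = List.map (uncurry (cellAt c)) (offDiagonal k)

      crossings-unique : ∀ c → Unique (crossings c)
      crossings-unique c = Unique.map⁺
        (λ { {i , j} {i₁ , j₁} eq → cong₂ _,_ (row-injective c {i} {j} {i₁} {j₁} (cong proj₁ eq))
                                              (column-injective c {i} {j} {i₁} {j₁} (cong proj₂ eq)) })
        (offDiagonal-unique k)

      length-crossings : ∀ c → length (crossings c) ≡ length (offDiagonal k)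
      length-crossings c = List.length-map _ (offDiagonal k)

      -- Distinct cells of the matching have distinct indices, hence neither a row nor a column in
      -- common; an edge joining them would be a crossing, and those are all absent.
      good⇒independent : ∀ {G} c → Good G (crossings c) → Independent G (chunkCells c)
      good⇒independent {G} c good e@((a , b) , _) f@((a₁ , b₁) , _) (i , eq) (j , eq₁) e≢f = conflict
        where
        i≢j : i ≢ j
        i≢j i≡j = e≢f (edge-≡ G e f (trans eq (trans (cong (λ i → cellAt c i i) i≡j) (sym eq₁))))
        non-adjacent : ∀ {i j} → i ≢ j → ¬ Adj G (proj₁ (cellAt c i j)) (proj₂ (cellAt c i j))
        non-adjacent {i} {j} i≢j ij
          with () ← trans (sym (All.lookup good (∈.∈-map⁺ (uncurry (cellAt c)) (∈-offDiagonal⁺ i≢j)))) (adj⇒bit G ij)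
        conflict : ¬ (ShareVertex G e f ⊎ JoinedByEdge G e f)
        conflict (inj₁ (inj₁ a≡a₁)) = i≢j (row-injective c {i} {i} {j} {j}
          (trans (sym (cong proj₁ eq)) (trans a≡a₁ (cong proj₁ eq₁))))
        conflict (inj₁ (inj₂ b≡b₁)) = i≢j (column-injective c {i} {i} {j} {j}
          (trans (sym (cong proj₂ eq)) (trans b≡b₁ (cong proj₂ eq₁))))
        conflict (inj₂ (inj₁ ab₁)) = non-adjacent i≢j (subst₂ (Adj G) (cong proj₁ eq) (cong proj₂ eq₁) ab₁)
        conflict (inj₂ (inj₂ a₁b)) = non-adjacent (i≢j ∘ sym) (subst₂ (Adj G) (cong proj₁ eq₁) (cong proj₂ eq) a₁b)

      -- The shift is forced: point `coord t s` of the first line has to be matched with point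
      -- `coord t s₁` of the second.
      chunkOf : Site uA → Site uB → Fin T → Chunk
      chunkOf s s₁ t = t , lineOf t s , lineOf t s₁ , coord t s₁ ⊟ coord t s

      ∈-chunkOf : ∀ s s₁ t → chunkCells (chunkOf s s₁ t) (vertex rA s , vertex rB s₁)
      ∈-chunkOf s s₁ t = coord t s , cong₂ (λ s s₁ → vertex rA s , vertex rB s₁) (sym (point-lineOf t s))
        (sym (trans (cong (point t (lineOf t s₁)) (⊞-solve (coord t s) (coord t s₁))) (point-lineOf t s₁)))

      -- Two chunks through the cell (s , s₁) in directions t ≢ t₁ meet only in its row
      -- and column, and these are on the diagonal of either chunk.
      crossings-disjoint : ∀ s s₁ {t t₁} → t ≢ t₁ →
        Disjoint (crossings (chunkOf s s₁ t)) (crossings (chunkOf s s₁ t₁))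
      crossings-disjoint s s₁ {t} {t₁} t≢t₁ (x∈ , x∈₁)
        with (i , j) , ij∈ , refl ← ∈.∈-map⁻ (uncurry (cellAt (chunkOf s s₁ t))) x∈
        with (i₁ , j₁) , _ , eq ← ∈.∈-map⁻ (uncurry (cellAt (chunkOf s s₁ t₁))) x∈₁ =
        ∈-offDiagonal⁻ ij∈ (trans i≡ (sym j≡))
        where
        d d₁ : Fin k
        d = coord t s₁ ⊟ coord t s
        d₁ = coord t₁ s₁ ⊟ coord t₁ s
        i≡ : i ≡ coord t s
        i≡ = trans (coord-vertex rA t (lineOf t s) i (point t₁ (lineOf t₁ s) i₁) (cong proj₁ eq))
          (coord-point-≢ s i₁ (t≢t₁ ∘ sym))
        j≡ : j ≡ coord t s
        j≡ = ⊞-cancelʳ d (trans (coord-vertex rB t (lineOf t s₁) (j ⊞ d) (point t₁ (lineOf t₁ s₁) (j₁ ⊞ d₁)) (cong proj₂ eq))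
          (trans (coord-point-≢ s₁ (j₁ ⊞ d₁) (t≢t₁ ∘ sym)) (sym (⊞-solve (coord t s) (coord t s₁)))))

  -- The expected number of colours

  module _ {nA nB : ℕ} (G : Graph nA nB) where

    good? : Decidable (Good G)
    good? = All.all? (λ x → bit x G Bool.≟ false)

    Uncovered : List (List (Cell nA nB)) → Set
    Uncovered = All (λ L → ¬ Good G L)

    uncovered? : Decidable Uncovered
    uncovered? = All.all? (λ L → ¬? (good? L))

    good⇒vacant : ∀ {L} → Good G L → vacant L G ≡ 1ℚ
    good⇒vacant []           = refl
    good⇒vacant (off ∷ good) = cong₂ (λ b → absent {nA} {nB} b *_) off (good⇒vacant good)

    ¬good⇒vacant : ∀ L → ¬ Good G L → vacant L G ≡ 0ℚ
    ¬good⇒vacant []      ¬good = contradiction [] ¬good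
    ¬good⇒vacant (x ∷ L) ¬good with bit x G in eq
    ... | true  = *-zeroˡ (vacant L G)
    ... | false = trans (*-identityˡ (vacant L G)) (¬good⇒vacant L (λ good → ¬good (eq ∷ good)))

    indicator-good : ∀ L → indicator (good? L) ≡ vacant L G
    indicator-good L with good? L
    ... | yes good = sym (good⇒vacant good)
    ... | no ¬good = sym (¬good⇒vacant L ¬good)

    0≤noneVacant : ∀ Ls → 0ℚ ≤ noneVacant Ls G
    0≤noneVacant []       = 0≤1
    0≤noneVacant (L ∷ Ls) = 0≤* (p≤q⇒0≤q-p (subst (_≤ 1ℚ) (indicator-good L) (indicator-≤1 (good? L)))) (0≤noneVacant Ls)

    uncovered⇒noneVacant : ∀ {Ls} → Uncovered Ls → noneVacant Ls G ≡ 1ℚ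
    uncovered⇒noneVacant []                          = refl
    uncovered⇒noneVacant {L ∷ Ls} (¬good ∷ uncovered) =
      cong₂ (λ s t → (1ℚ - s) * t) (¬good⇒vacant L ¬good) (uncovered⇒noneVacant uncovered)

    indicator-uncovered : ∀ Ls → indicator (uncovered? Ls) ≤ noneVacant Ls G
    indicator-uncovered Ls with uncovered? Ls
    ... | yes uncovered = ≤-reflexive (sym (uncovered⇒noneVacant uncovered))
    ... | no _          = 0≤noneVacant Ls

    single-independent : ∀ x → Independent G (_≡ x)
    single-independent x e f e≡x f≡x e≢f _ = e≢f (edge-≡ G e f (trans e≡x (sym f≡x)))

  ι-length-filter : ∀ {X : Set} {P : Pred X 0ℓ} (P? : Decidable P) L →
    ι (length (List.filter P? L)) ≡ ∑ˡ (λ x → indicator (P? x)) L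
  ι-length-filter P? []      = refl
  ι-length-filter P? (x ∷ L) with P? x
  ... | yes _ = cong (1ℚ +_) (ι-length-filter P? L)
  ... | no _  = trans (ι-length-filter P? L) (sym (+-identityˡ _))

  𝔼-∑ˡ-≤ : ∀ {X Y : Set} (D : Expectation X) (f : Y → X → ℚ) {c} → (∀ y → 𝔼 D (f y) ≤ c) →
           ∀ L → 𝔼 D (λ x → ∑ˡ (λ y → f y x) L) ≤ ι (length L) * c
  𝔼-∑ˡ-≤ D f {c} Ef≤c []      = ≤-reflexive (trans (𝔼-const D 0ℚ) (sym (*-zeroˡ c)))
  𝔼-∑ˡ-≤ D f {c} Ef≤c (y ∷ L) = ≤-trans (≤-reflexive (𝔼-+ D (f y) _))
    (≤-trans (+-mono-≤ (Ef≤c y) (𝔼-∑ˡ-≤ D f Ef≤c L))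
      (≤-reflexive (solve 2 (λ c n → c :+ n :* c := (con 1ℚ :+ n) :* c) refl c (ι (length L)))))

  -- The colour classes and their expected number

  module Cover (k′ T′ rA uA rB uB : ℕ) where

    open Blocks k′ T′
    open Grid rA uA rB uB

    leftovers : List (Cell nA nB)
    leftovers = cartesianProduct (remainder rA uA) (allFin nB) ++ cartesianProduct (allFin nA) (remainder rB uB)

    length-leftovers : length leftovers ≡ rA ℕ.* nB ℕ.+ nA ℕ.* rB
    length-leftovers = trans (List.length-++ (cartesianProduct (remainder rA uA) (allFin nB)))
      (cong₂ ℕ._+_
        (trans (length-cartesianProductWith _,_ (remainder rA uA) (allFin nB))
          (cong₂ ℕ._*_ (length-remainder rA uA) (length-allFin nB)))
        (trans (length-cartesianProductWith _,_ (allFin nA) (remainder rB uB))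
          (cong₂ ℕ._*_ (length-allFin nA) (length-remainder rB uB))))

    pairs : List (Site uA × Site uB)
    pairs = cartesianProduct (sites uA) (sites uB)

    length-pairs : length pairs ≡ (uA ℕ.* M) ℕ.* (uB ℕ.* M)
    length-pairs = trans (length-cartesianProductWith _,_ (sites uA) (sites uB))
      (cong₂ ℕ._*_ (length-sites uA) (length-sites uB))

    cell : Site uA × Site uB → Cell nA nB
    cell (s , s₁) = vertex rA s , vertex rB s₁

    crossingsThrough : Site uA × Site uB → List (List (Cell nA nB))
    crossingsThrough (s , s₁) = List.map (crossings ∘ chunkOf s s₁) (allFin T)

    module _ (G : Graph nA nB) where

      goodChunks : List Chunk
      goodChunks = List.filter (good? G ∘ crossings) chunks

      uncoveredPairs : List (Site uA × Site uB)
      uncoveredPairs = List.filter (uncovered? G ∘ crossingsThrough) pairs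

      -- Classes are sets of cells, whether edges or not. Whether a cell is uncovered is therefore
      -- decided by the crossings of its chunks alone, which do not include the cell.
      classes : List (Cell nA nB → Set)
      classes = List.map (λ x y → y ≡ x) leftovers ++
        (List.map chunkCells goodChunks ++ List.map (λ ss y → y ≡ cell ss) uncoveredPairs)

      classes-independent : All (Independent G) classes
      classes-independent = All.++⁺ (All.map⁺ (All.universal (single-independent G) leftovers))
        (All.++⁺
          (All.map⁺ (All.map (λ {c} → good⇒independent {G} c) (All.all-filter (good? G ∘ crossings) chunks)))
          (All.map⁺ (All.universal (single-independent G ∘ cell) uncoveredPairs)))

      leftovers-cover : ∀ {x} → x ∈ leftovers → Any (λ P → P x) classes
      leftovers-cover x∈ = Any.++⁺ˡ (Any.map⁺ x∈)

      pairs-cover : ∀ ss → Any (λ P → P (cell ss)) classes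
      pairs-cover ss@(s , s₁) with uncovered? G (crossingsThrough ss)
      ... | yes uncovered = Any.++⁺ʳ (List.map (λ x y → y ≡ x) leftovers) (Any.++⁺ʳ (List.map chunkCells goodChunks)
        (Any.map⁺ (Any.map (cong cell) (∈.∈-filter⁺ (uncovered? G ∘ crossingsThrough)
          (∈.∈-cartesianProduct⁺ (∈-sites s) (∈-sites s₁)) uncovered))))
      -- Some chunk through the cell fails to be bad; as `Good` is decidable, that chunk is good.
      ... | no covered with t , ¬¬good ← Any.satisfied (Any.map⁻ {f = crossings ∘ chunkOf s s₁} {xs = allFin T} (All.¬All⇒Any¬ (¬? ∘ good? G) (crossingsThrough ss) covered)) =
        Any.++⁺ʳ (List.map (λ x y → y ≡ x) leftovers) (Any.++⁺ˡ (Any.map⁺ (Any.map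
          (λ { refl → ∈-chunkOf s s₁ t })
          (∈.∈-filter⁺ (good? G ∘ crossings) (∈-chunks (chunkOf s s₁ t)) (decidable-stable (good? G _) ¬¬good)))))

      classes-cover : ∀ x → Any (λ P → P x) classes
      classes-cover (a , b) with locate rA uA a | locate rB uB b
      ... | inj₁ a∈ | _ = leftovers-cover
        (∈.∈-++⁺ˡ (∈.∈-cartesianProduct⁺ a∈ (∈.∈-allFin b)))
      ... | inj₂ _ | inj₁ b∈ = leftovers-cover
        (∈.∈-++⁺ʳ (cartesianProduct (remainder rA uA) (allFin nB)) (∈.∈-cartesianProduct⁺ (∈.∈-allFin a) b∈))
      ... | inj₂ (s , refl) | inj₂ (s₁ , refl) = pairs-cover (s , s₁)

      χ′ₛ-≤-classes : χ′ₛ G ℕ.≤ length classes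
      χ′ₛ-≤-classes = χ′ₛ-≤-cover G classes classes-independent (λ e → classes-cover (proj₁ e))

      -- Lengths of filtered lists become sums of indicators, ready for linearity of expectation.
      length-classes : ι (length classes) ≡ ι (length leftovers) +
        (∑ˡ (λ c → indicator (good? G (crossings c))) chunks +
         ∑ˡ (λ ss → indicator (uncovered? G (crossingsThrough ss))) pairs)
      length-classes = begin
        ι (length classes)
          ≡⟨ cong ι (trans (List.length-++ (List.map (λ x y → y ≡ x) leftovers)) (cong₂ ℕ._+_ (List.length-map _ leftovers)
               (trans (List.length-++ (List.map chunkCells goodChunks))
                 (cong₂ ℕ._+_ (List.length-map _ goodChunks) (List.length-map _ uncoveredPairs))))) ⟩
        ι (length leftovers ℕ.+ (length goodChunks ℕ.+ length uncoveredPairs))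
          ≡⟨ trans (ι-+ (length leftovers) _) (cong (ι (length leftovers) +_) (ι-+ (length goodChunks) _)) ⟩
        ι (length leftovers) + (ι (length goodChunks) + ι (length uncoveredPairs))
          ≡⟨ cong (ι (length leftovers) +_) (cong₂ _+_
               (ι-length-filter (good? G ∘ crossings) chunks)
               (ι-length-filter (uncovered? G ∘ crossingsThrough) pairs)) ⟩
        ι (length leftovers) +
        (∑ˡ (λ c → indicator (good? G (crossings c))) chunks +
         ∑ˡ (λ ss → indicator (uncovered? G (crossingsThrough ss))) pairs) ∎
        where open ≡-Reasoning

    module _ (p : ℚ) (0≤p : 0ℚ ≤ p) (p≤1 : p ≤ 1ℚ) where

      private
        D : Expectation (Graph nA nB)
        D = graphᴱ p 0≤p p≤1 nA nB
        ρ : ℚ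
        ρ = (1ℚ - p) ^ length (offDiagonal k)

      𝔼-good : ∀ c → 𝔼 D (λ G → indicator (good? G (crossings c))) ≤ ρ
      𝔼-good c = ≤-reflexive (trans (𝔼-cong D λ G → indicator-good G (crossings c))
        (trans (𝔼-vacant p 0≤p p≤1 (crossings c) (crossings-unique c))
          (cong ((1ℚ - p) ^_) (length-crossings c))))

      𝔼-uncovered : ∀ ss → 𝔼 D (λ G → indicator (uncovered? G (crossingsThrough ss))) ≤ (1ℚ - ρ) ^ T
      𝔼-uncovered ss@(s , s₁) = ≤-trans (𝔼-mono D λ G → indicator-uncovered G (crossingsThrough ss))
        (≤-reflexive (trans
          (𝔼-noneVacant p 0≤p p≤1 (length (offDiagonal k)) (crossingsThrough ss)
            (All.map⁺ (All.universal (length-crossings ∘ chunkOf s s₁) (allFin T)))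
            (All.map⁺ (All.universal (crossings-unique ∘ chunkOf s s₁) (allFin T)))
            (AllPairs.map⁺ (AllPairs.map (λ t≢t₁ {x} → crossings-disjoint s s₁ t≢t₁ {x}) (Unique.allFin⁺ T))))
          (cong ((1ℚ - ρ) ^_) (trans (List.length-map _ (allFin T)) (length-allFin T)))))

      𝔼-length-classes : 𝔼 D (λ G → ι (length (classes G))) ≤
        ι (length leftovers) + (ι (length chunks) * ρ + ι (length pairs) * (1ℚ - ρ) ^ T)
      𝔼-length-classes = ≤-trans
        (≤-reflexive (trans (𝔼-cong D length-classes) (trans (𝔼-+ D (λ _ → ι (length leftovers)) _)
          (cong₂ _+_ (𝔼-const D (ι (length leftovers))) (𝔼-+ D _ _)))))
        (+-monoʳ-≤ (ι (length leftovers)) (+-mono-≤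
          (𝔼-∑ˡ-≤ D (λ c G → indicator (good? G (crossings c))) 𝔼-good chunks)
          (𝔼-∑ˡ-≤ D (λ ss G → indicator (uncovered? G (crossingsThrough ss))) 𝔼-uncovered pairs)))

  -- Degrees

  module _ {nA nB : ℕ} (G : Graph nA nB) where

    degree≤ΔA : ∀ a → ∣ neighboursA G a ∣ ℕ.≤ ΔA G
    degree≤ΔA a = All.lookup (Extrema.xs≤max 0 _) (∈.∈-map⁺ (λ a → ∣ neighboursA G a ∣) (∈.∈-allFin a))

    degree≤ΔB : ∀ b → ∣ neighboursB G b ∣ ℕ.≤ ΔB G
    degree≤ΔB b = All.lookup (Extrema.xs≤max 0 _) (∈.∈-map⁺ (λ b → ∣ neighboursB G b ∣) (∈.∈-allFin b))

  centred : ℚ → Bool → ℚ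
  centred p true  = 1ℚ - p
  centred p false = 0ℚ - p

  ∑ᵛ-map : ∀ {X Y : Set} (g : Y → ℚ) (h : X → Y) {n} (xs : Vec X n) → ∑ᵛ g (Vec.map h xs) ≡ ∑ᵛ (g ∘ h) xs
  ∑ᵛ-map g h []       = refl
  ∑ᵛ-map g h (x ∷ xs) = cong (g (h x) +_) (∑ᵛ-map g h xs)

  ∑ᵛ-centred : ∀ p {n} (N : Vec Bool n) → ∑ᵛ (centred p) N ≡ ι ∣ N ∣ - ι n * p
  ∑ᵛ-centred p []                  = solve 1 (λ p → con 0ℚ := con 0ℚ :- con 0ℚ :* p) refl p
  ∑ᵛ-centred p {suc n} (true ∷ N)  = trans (cong (1ℚ - p +_) (∑ᵛ-centred p N))
    (solve 3 (λ p d n → (con 1ℚ :- p) :+ (d :- n :* p) := (con 1ℚ :+ d) :- (con 1ℚ :+ n) :* p) refl p (ι ∣ N ∣) (ι n))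
  ∑ᵛ-centred p {suc n} (false ∷ N) = trans (cong (0ℚ - p +_) (∑ᵛ-centred p N))
    (solve 3 (λ p d n → (con 0ℚ :- p) :+ (d :- n :* p) := d :- (con 1ℚ :+ n) :* p) refl p (ι ∣ N ∣) (ι n))

  -- The mean n p is at least n / Q, so a degree of at most n / (2Q) misses it by at least n / (2Q).
  low-degree-deviation : ∀ Q p {n d} → 1ℚ ≤ ι Q * p → 2 ℕ.* Q ℕ.* d ℕ.≤ n →
    ι (n ℕ.* n) ≤ ι (4 ℕ.* (Q ℕ.* Q)) * ((ι d - ι n * p) * (ι d - ι n * p))
  low-degree-deviation Q p {n} {d} 1≤Qp 2Qd≤n = subst₂ _≤_ (sym (ι-* n n)) square
    (*-mono (≤-trans (0≤ι n) n≤x) (0≤ι n) n≤x n≤x)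
    where
    x : ℚ
    x = ι 2 * ι Q * (ι n * p - ι d)
    2Qd≤n′ : ι 2 * ι Q * ι d ≤ ι n
    2Qd≤n′ = subst (_≤ ι n) (trans (ι-* (2 ℕ.* Q) d) (cong (_* ι d) (ι-* 2 Q))) (ι-mono 2Qd≤n)
    n≤x : ι n ≤ x
    n≤x = 0≤q-p⇒p≤q (subst (0ℚ ≤_)
      -- The difference x - n is 2 n (Q p - 1) + (n - 2 Q d), and each summand is nonnegative by one
      -- hypothesis.
      (solve 4 (λ q p n d → con (ι 2) :* (n :* (q :* p :- con 1ℚ)) :+ (n :- con (ι 2) :* q :* d) :=
        con (ι 2) :* q :* (n :* p :- d) :- n) refl (ι Q) p (ι n) (ι d))
      (0≤+ (0≤* (0≤ι 2) (0≤* (0≤ι n) (p≤q⇒0≤q-p 1≤Qp))) (p≤q⇒0≤q-p 2Qd≤n′)))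
    square : x * x ≡ ι (4 ℕ.* (Q ℕ.* Q)) * ((ι d - ι n * p) * (ι d - ι n * p))
    square = trans
      (solve 3 (λ q np d → (con (ι 2) :* q :* (np :- d)) :* (con (ι 2) :* q :* (np :- d)) :=
        con (ι 4) :* (q :* q) :* ((d :- np) :* (d :- np))) refl (ι Q) (ι n * p) (ι d))
      (cong (_* ((ι d - ι n * p) * (ι d - ι n * p)))
        (sym (trans (ι-* 4 (Q ℕ.* Q)) (cong (ι 4 *_) (ι-* Q Q)))))

  -- The integer `R` stands for 1 / δ. The same form serves as Markov's inequality for the number of
  -- colours and, with `f` a squared deviation, as Chebyshev's for the degrees.
  markov-inverse : ∀ {X} (D : Expectation X) {P : X → Set} (P? : ∀ x → Dec (P x)) (f : X → ℚ) {s δ} R →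
    0ℚ < s → 0ℚ < ι R → 1ℚ ≤ ι R * δ → (∀ x → 0ℚ ≤ f x) → (∀ x → P x → s ≤ f x) → ι R * 𝔼 D f ≤ s →
    𝔼 D (λ x → indicator (P? x)) ≤ δ
  markov-inverse D P? f {s} {δ} R 0<s 0<R 1≤Rδ 0≤f s≤f REf≤s = markov D P? 0<s 0≤f s≤f
    (*-cancelˡ 0<R (≤-trans REf≤s (subst₂ _≤_ (*-identityʳ s)
      (solve 3 (λ s r δ → s :* (r :* δ) := r :* (s :* δ)) refl s (ι R) δ) (*-monoˡ (<⇒≤ 0<s) 1≤Rδ))))

  module _ (p : ℚ) (0≤p : 0ℚ ≤ p) (p≤1 : p ≤ 1ℚ) where

    private
      B : Expectation Bool
      B = bernoulliᴱ p 0≤p p≤1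

    𝔼-centred : 𝔼 B (centred p) ≡ 0ℚ
    𝔼-centred = solve 1 (λ p → p :* (con 1ℚ :- p) :+ (con 1ℚ :- p) :* (con 0ℚ :- p) := con 0ℚ) refl p

    𝔼-centred² : 𝔼 B (λ b → centred p b * centred p b) ≤ 1ℚ
    𝔼-centred² = 0≤q-p⇒p≤q (subst (0ℚ ≤_)
      (solve 1 (λ p → (con 1ℚ :- p) :+ p :* p := con 1ℚ :-
        (p :* ((con 1ℚ :- p) :* (con 1ℚ :- p)) :+ (con 1ℚ :- p) :* ((con 0ℚ :- p) :* (con 0ℚ :- p)))) refl p)
      (0≤+ (p≤q⇒0≤q-p p≤1) (0≤p² p)))

    private
      -- Chebyshev's inequality compares a variance of at most n with the squared deviation n² / (4
      -- Q²); the ratio is at most 1 / R once n is at least 4 Q² R.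
      scale-≤ : ∀ Q R n {e} → 4 ℕ.* (Q ℕ.* Q) ℕ.* R ℕ.≤ n → e ≤ ι n → ι R * (ι (4 ℕ.* (Q ℕ.* Q)) * e) ≤ ι (n ℕ.* n)
      scale-≤ Q R n {e} 4Q²R≤n e≤n = ≤-trans (*-monoˡ (0≤ι R) (*-monoˡ (0≤ι c) e≤n)) (subst₂ _≤_
        (trans (cong (_* ι n) (ι-* c R)) (solve 3 (λ c r n → c :* r :* n := r :* (c :* n)) refl (ι c) (ι R) (ι n)))
        (sym (ι-* n n))
        (*-monoʳ (0≤ι n) (ι-mono 4Q²R≤n)))
        where
        c : ℕ
        c = 4 ℕ.* (Q ℕ.* Q)

      ι²>0 : ∀ n → 0ℚ < ι (suc n ℕ.* suc n)
      ι²>0 n = 0<ι {suc n ℕ.* suc n} z<s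

    low-degree-A : ∀ Q R {δ} nA′ nB′ (let nA = suc nA′; nB = suc nB′) →
      1ℚ ≤ ι Q * p → 0ℚ < ι R → 1ℚ ≤ ι R * δ → 4 ℕ.* (Q ℕ.* Q) ℕ.* R ℕ.≤ nB →
      𝔼 (graphᴱ p 0≤p p≤1 nA nB) (λ G → indicator (2 ℕ.* Q ℕ.* ∣ neighboursA G zero ∣ ℕ.≤? nB)) ≤ δ
    low-degree-A Q R nA′ nB′ 1≤Qp 0<R 1≤Rδ 4Q²R≤n = markov-inverse D
      (λ G → 2 ℕ.* Q ℕ.* ∣ neighboursA G zero ∣ ℕ.≤? nB) (λ G → c * (X G * X G)) R (ι²>0 nB′) 0<R 1≤Rδ
      (λ G → 0≤* (0≤ι (4 ℕ.* (Q ℕ.* Q))) (0≤p² (X G)))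
      (λ G low → subst (λ x → ι (nB ℕ.* nB) ≤ c * (x * x)) (sym (∑ᵛ-centred p (lookup G zero)))
        (low-degree-deviation Q p 1≤Qp low))
      (subst (λ e → ι R * e ≤ ι (nB ℕ.* nB)) (sym (𝔼-* D c (λ G → X G * X G)))
        (scale-≤ Q R nB 4Q²R≤n (≤-trans (≤-reflexive first-row)
          (variance B {centred p} 𝔼-centred 𝔼-centred² nB))))
      where
      nA nB : ℕ
      nA = suc nA′
      nB = suc nB′
      c : ℚ
      c = ι (4 ℕ.* (Q ℕ.* Q))
      D : Expectation (Graph nA nB)
      D = graphᴱ p 0≤p p≤1 nA nB
      X : Graph nA nB → ℚ
      X G = ∑ᵛ (centred p) (lookup G zero)
      first-row : 𝔼 D (λ G → X G * X G) ≡ 𝔼 (vecᴱ B nB) (λ N → ∑ᵛ (centred p) N * ∑ᵛ (centred p) N)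
      first-row = 𝔼-cong (vecᴱ B nB) λ N →
        𝔼-const (vecᴱ (vecᴱ B nB) nA′) (∑ᵛ (centred p) N * ∑ᵛ (centred p) N)

    -- A column is spread over the rows, so `variance` is applied with an entire row as one outcome
    -- and the centred first bit of that row as its random variable.
    low-degree-B : ∀ Q R {δ} nA′ nB′ (let nA = suc nA′; nB = suc nB′) →
      1ℚ ≤ ι Q * p → 0ℚ < ι R → 1ℚ ≤ ι R * δ → 4 ℕ.* (Q ℕ.* Q) ℕ.* R ℕ.≤ nA →
      𝔼 (graphᴱ p 0≤p p≤1 nA nB) (λ G → indicator (2 ℕ.* Q ℕ.* ∣ neighboursB G zero ∣ ℕ.≤? nA)) ≤ δ
    low-degree-B Q R nA′ nB′ 1≤Qp 0<R 1≤Rδ 4Q²R≤n = markov-inverse D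
      (λ G → 2 ℕ.* Q ℕ.* ∣ neighboursB G zero ∣ ℕ.≤? nA) (λ G → c * (X G * X G)) R (ι²>0 nA′) 0<R 1≤Rδ
      (λ G → 0≤* (0≤ι (4 ℕ.* (Q ℕ.* Q))) (0≤p² (X G)))
      (λ G low → subst (λ x → ι (nA ℕ.* nA) ≤ c * (x * x))
        (trans (sym (∑ᵛ-centred p (neighboursB G zero))) (∑ᵛ-map (centred p) (λ N → lookup N zero) G))
        (low-degree-deviation Q p 1≤Qp low))
      (subst (λ e → ι R * e ≤ ι (nA ℕ.* nA)) (sym (𝔼-* D c (λ G → X G * X G)))
        (scale-≤ Q R nA 4Q²R≤n (variance (vecᴱ B nB) {λ N → centred p (lookup N zero)}
          (trans (first-bit (centred p)) 𝔼-centred)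
          (≤-trans (≤-reflexive (first-bit (λ b → centred p b * centred p b))) 𝔼-centred²) nA)))
      where
      nA nB : ℕ
      nA = suc nA′
      nB = suc nB′
      c : ℚ
      c = ι (4 ℕ.* (Q ℕ.* Q))
      D : Expectation (Graph nA nB)
      D = graphᴱ p 0≤p p≤1 nA nB
      X : Graph nA nB → ℚ
      X G = ∑ᵛ (λ N → centred p (lookup N zero)) G
      first-bit : ∀ g → 𝔼 (vecᴱ B nB) (λ N → g (lookup N zero)) ≡ 𝔼 B g
      first-bit g = 𝔼-cong B λ b → 𝔼-const (vecᴱ B nB′) (g b)

  -- Choice of the parameters

  module _ (k′ T′ : ℕ) (p : ℚ) (0≤p : 0ℚ ≤ p) (p≤1 : p ≤ 1ℚ) where

    open Blocks k′ T′ using (k; T; M)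

    private
      ρ : ℚ
      ρ = (1ℚ - p) ^ length (offDiagonal k)

      -- Here `U` counts the classes and `C` the chunks. The block structure is hidden, so that a
      -- cover built for sizes of the form r + u M can be transported to any sizes by division with
      -- remainder.
      HasCover : ℕ → ℕ → Set
      HasCover nA nB = Σ[ U ∈ (Graph nA nB → ℕ) ] ∃[ C ]
        (∀ G → χ′ₛ G ℕ.≤ U G) ×
        C ℕ.* k ℕ.≤ T ℕ.* (nA ℕ.* nB) ×
        𝔼 (graphᴱ p 0≤p p≤1 nA nB) (λ G → ι (U G)) ≤
          ι (M ℕ.* (nA ℕ.+ nB)) + (ι C * ρ + ι (nA ℕ.* nB) * (1ℚ - ρ) ^ T)

      0≤ρ : 0ℚ ≤ ρ
      0≤ρ = 0≤^ (length (offDiagonal k)) (p≤q⇒0≤q-p p≤1)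

      ρ≤1 : ρ ≤ 1ℚ
      ρ≤1 = ^≤1 (length (offDiagonal k)) (p≤q⇒0≤q-p p≤1)
        (0≤q-p⇒p≤q (subst (0ℚ ≤_) (solve 1 (λ p → p := con 1ℚ :- (con 1ℚ :- p)) refl p) 0≤p))

      block-cover : ∀ rA uA rB uB → rA ℕ.≤ M → rB ℕ.≤ M → HasCover (rA ℕ.+ uA ℕ.* M) (rB ℕ.+ uB ℕ.* M)
      block-cover rA uA rB uB rA≤M rB≤M =
        (λ G → length (classes G)) , length chunks , χ′ₛ-≤-classes , chunks-few ,
        ≤-trans (𝔼-length-classes p 0≤p p≤1) (+-mono-≤ (ι-mono leftovers-few)
          (+-monoʳ-≤ (ι (length chunks) * ρ) (*-monoʳ (0≤^ T (p≤q⇒0≤q-p ρ≤1)) (ι-mono pairs-few))))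
        where
        open Blocks k′ T′ using (module Grid)
        open Grid rA uA rB uB using (nA; nB; chunks; length-chunks)
        open Cover k′ T′ rA uA rB uB
        inner : (uA ℕ.* M) ℕ.* (uB ℕ.* M) ℕ.≤ nA ℕ.* nB
        inner = ℕ.*-mono-≤ (ℕ.m≤n+m (uA ℕ.* M) rA) (ℕ.m≤n+m (uB ℕ.* M) rB)
        -- Double counting: a cell of the blocks lies in `T` chunks, and a chunk has `k` cells.
        chunks-few : length chunks ℕ.* k ℕ.≤ T ℕ.* (nA ℕ.* nB)
        chunks-few = ℕ.≤-trans
          (ℕ.≤-reflexive (trans (cong (ℕ._* k) length-chunks) (regroup T uA uB (k ℕ.^ T′) k)))
          (ℕ.*-monoʳ-≤ T inner)
          where
          regroup : ∀ t a b m k → t ℕ.* (a ℕ.* m ℕ.* (b ℕ.* m ℕ.* k)) ℕ.* k ≡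
                                  t ℕ.* (a ℕ.* (k ℕ.* m) ℕ.* (b ℕ.* (k ℕ.* m)))
          regroup = solve-∀
        pairs-few : length pairs ℕ.≤ nA ℕ.* nB
        pairs-few = ℕ.≤-trans (ℕ.≤-reflexive length-pairs) inner
        leftovers-few : length leftovers ℕ.≤ M ℕ.* (nA ℕ.+ nB)
        leftovers-few = ℕ.≤-trans (ℕ.≤-reflexive length-leftovers)
          (ℕ.≤-trans (ℕ.+-mono-≤ (ℕ.*-monoˡ-≤ nB rA≤M) (ℕ.*-monoʳ-≤ nA rB≤M))
            (ℕ.≤-reflexive (regroup M nA nB)))
          where
          regroup : ∀ m a b → m ℕ.* b ℕ.+ a ℕ.* m ≡ m ℕ.* (a ℕ.+ b)
          regroup = solve-∀

    cover : ∀ nA nB → HasCover nA nB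
    cover nA nB = subst₂ HasCover (sym (ℕ.m≡m%n+[m/n]*n nA M)) (sym (ℕ.m≡m%n+[m/n]*n nB M))
      (block-cover (nA ℕ.% M) (nA ℕ./ M) (nB ℕ.% M) (nB ℕ./ M)
        (ℕ.<⇒≤ (ℕ.m%n<n nA M)) (ℕ.<⇒≤ (ℕ.m%n<n nB M)))
      where
      instance
        M≢0 : ℕ.NonZero M
        M≢0 = ℕ.m^n≢0 k T

    -- Each of the three costs is at most nA nB / H: the leftovers because both sides are at least 2
    -- H M, the chunks because T ρ ≤ H + 1 while k ≥ H (H + 1), and the uncovered cells by
    -- Bernoulli's inequality, because T ρ ≥ H.
    cover-cheap : ∀ H nA nB → H ℕ.* suc H ℕ.≤ suc k′ → 2 ℕ.* (H ℕ.* M) ℕ.≤ nA → 2 ℕ.* (H ℕ.* M) ℕ.≤ nB →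
      ι T′ * ρ ≤ ι H → ι H ≤ ι T * ρ →
      let U = proj₁ (cover nA nB) in ι H * 𝔼 (graphᴱ p 0≤p p≤1 nA nB) (λ G → ι (U G)) ≤ ι 3 * ι (nA ℕ.* nB)
    cover-cheap H nA nB k-large A-large B-large T′ρ≤H H≤Tρ = ≤-trans (*-monoˡ (0≤ι H) 𝔼U≤)
      (subst₂ _≤_
        (solve 4 (λ h a b c → h :* a :+ (h :* b :+ h :* c) := h :* (a :+ (b :+ c))) refl (ι H) _ _ _)
        (solve 1 (λ x → x :+ (x :+ x) := con (ι 3) :* x) refl N)
        (+-mono-≤ leftovers-cheap (+-mono-≤ chunks-cheap pairs-cheap)))
      where
      N σ : ℚ
      N = ι (nA ℕ.* nB)
      σ = 1ℚ - ρ
      C : ℕ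
      C = proj₁ (proj₂ (cover nA nB))
      Ck≤ : C ℕ.* k ℕ.≤ T ℕ.* (nA ℕ.* nB)
      Ck≤ = proj₁ (proj₂ (proj₂ (proj₂ (cover nA nB))))
      𝔼U≤ : 𝔼 (graphᴱ p 0≤p p≤1 nA nB) (λ G → ι (proj₁ (cover nA nB) G)) ≤
        ι (M ℕ.* (nA ℕ.+ nB)) + (ι C * ρ + N * σ ^ T)
      𝔼U≤ = proj₂ (proj₂ (proj₂ (proj₂ (cover nA nB))))

      leftovers-cheap : ι H * ι (M ℕ.* (nA ℕ.+ nB)) ≤ N
      leftovers-cheap = subst (_≤ N) (ι-* H (M ℕ.* (nA ℕ.+ nB))) (ι-mono {H ℕ.* (M ℕ.* (nA ℕ.+ nB))} {nA ℕ.* nB} (ℕ.*-cancelˡ-≤ 2 (ℕ.≤-trans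
        (ℕ.≤-reflexive (regroup₁ H M nA nB))
        (ℕ.≤-trans (ℕ.+-mono-≤ (ℕ.*-monoˡ-≤ nA B-large) (ℕ.*-monoˡ-≤ nB A-large))
          (ℕ.≤-reflexive (regroup₂ nA nB))))))
        where
        regroup₁ : ∀ h m a b → 2 ℕ.* (h ℕ.* (m ℕ.* (a ℕ.+ b))) ≡ 2 ℕ.* (h ℕ.* m) ℕ.* a ℕ.+ 2 ℕ.* (h ℕ.* m) ℕ.* b
        regroup₁ = solve-∀
        regroup₂ : ∀ a b → b ℕ.* a ℕ.+ a ℕ.* b ≡ 2 ℕ.* (a ℕ.* b)
        regroup₂ = solve-∀

      -- The round by which `T` exceeds `T′` adds only ρ ≤ 1.
      Tρ≤1+H : ι T * ρ ≤ ι (suc H)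
      Tρ≤1+H = subst (_≤ ι (suc H)) (solve 2 (λ t ρ → ρ :+ t :* ρ := (con 1ℚ :+ t) :* ρ) refl (ι T′) ρ)
        (+-mono-≤ ρ≤1 T′ρ≤H)

      chunks-cheap : ι H * (ι C * ρ) ≤ N
      chunks-cheap = *-cancelˡ (0<ι {suc H} z<s) (begin
        ι (suc H) * (ι H * (ι C * ρ))
          ≡⟨ solve 4 (λ s h c ρ → s :* (h :* (c :* ρ)) := c :* (h :* s) :* ρ) refl (ι (suc H)) (ι H) (ι C) ρ ⟩
        ι C * (ι H * ι (suc H)) * ρ
          ≤⟨ *-monoʳ 0≤ρ (*-monoˡ (0≤ι C) (subst (_≤ ι k) (ι-* H (suc H)) (ι-mono k-large))) ⟩
        ι C * ι k * ρ
          ≡⟨ cong (_* ρ) (sym (ι-* C k)) ⟩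
        ι (C ℕ.* k) * ρ
          ≤⟨ *-monoʳ 0≤ρ (ι-mono Ck≤) ⟩
        ι (T ℕ.* (nA ℕ.* nB)) * ρ
          ≡⟨ cong (_* ρ) (ι-* T (nA ℕ.* nB)) ⟩
        ι T * N * ρ
          ≡⟨ solve 3 (λ t n ρ → t :* n :* ρ := (t :* ρ) :* n) refl (ι T) N ρ ⟩
        (ι T * ρ) * N
          ≤⟨ *-monoʳ (0≤ι (nA ℕ.* nB)) Tρ≤1+H ⟩
        ι (suc H) * N ∎)
        where open ≤-Reasoning

      pairs-cheap : ι H * (N * σ ^ T) ≤ N
      pairs-cheap = subst₂ _≤_
        (solve 3 (λ n s h → n :* (s :* h) := h :* (n :* s)) refl N (σ ^ T) (ι H)) (*-identityʳ N)
        (*-monoˡ (0≤ι (nA ℕ.* nB)) (≤-trans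
          (*-monoˡ (0≤^ T (p≤q⇒0≤q-p ρ≤1)) (≤-trans H≤Tρ
            (subst (_≤ 1ℚ + ι T * ρ) (+-identityˡ (ι T * ρ)) (+-monoˡ-≤ (ι T * ρ) 0≤1))))
          (bernoulli-inequality T 0≤ρ ρ≤1)))

  -- Failure probability for a rational edge probability

  1≤indicator+ : ∀ {P : Set} (P? : Dec P) {r} → 0ℚ ≤ r → (¬ P → 1ℚ ≤ r) → 1ℚ ≤ indicator P? + r
  1≤indicator+ (yes _)     0≤r _   = +-monoʳ-≤ 1ℚ 0≤r
  1≤indicator+ (no ¬p) {r} _   1≤r = subst (1ℚ ≤_) (sym (+-identityˡ r)) (1≤r ¬p)

  -- The three negations combine to 4 Q² U < nA nB ≤ (2 Q dB) (2 Q dA).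
  ≤-from-degrees : ∀ Q {U nA nB dA dB} → ¬ nA ℕ.* nB ℕ.≤ 4 ℕ.* (Q ℕ.* Q) ℕ.* U →
    ¬ 2 ℕ.* Q ℕ.* dA ℕ.≤ nB → ¬ 2 ℕ.* Q ℕ.* dB ℕ.≤ nA → U ℕ.≤ dA ℕ.* dB
  ≤-from-degrees Q {U} {nA} {nB} {dA} {dB} U-small dA-large dB-large = ℕ.<⇒≤ (ℕ.*-cancelˡ-< (4 ℕ.* (Q ℕ.* Q)) _ _
    (ℕ.<-≤-trans (ℕ.≰⇒> U-small) (ℕ.≤-trans
      (ℕ.*-mono-≤ (ℕ.<⇒≤ (ℕ.≰⇒> dB-large)) (ℕ.<⇒≤ (ℕ.≰⇒> dA-large)))
      (ℕ.≤-reflexive (regroup Q dA dB)))))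
    where
    regroup : ∀ q a b → 2 ℕ.* q ℕ.* b ℕ.* (2 ℕ.* q ℕ.* a) ≡ 4 ℕ.* (q ℕ.* q) ℕ.* (a ℕ.* b)
    regroup = solve-∀

  first-crossing : ∀ ρ h S → 0ℚ < h → h ≤ ι S * ρ → ∃[ n ] n ℕ.< S × ι n * ρ ≤ h × h ≤ ι (suc n) * ρ
  first-crossing ρ h zero    0<h h≤0 =
    contradiction (<-≤-trans 0<h (≤-trans h≤0 (≤-reflexive (*-zeroˡ ρ)))) (<-irrefl refl)
  first-crossing ρ h (suc S) 0<h h≤Sρ with ≤-total h (ι S * ρ)
  ... | inj₂ below = S , ℕ.n<1+n S , below , h≤Sρ
  ... | inj₁ above with n , n<S , bounds ← first-crossing ρ h S 0<h above = n , ℕ.m<n⇒m<1+n n<S , bounds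

  -- The number of rounds varies with `q`, while the bound H Q^ℓ on it depends only on a lower bound
  -- 1 / Q for `q`; recording it lets one bound on the sizes serve for all admissible `q`.
  ∃-rounds : ∀ Q ℓ H {q} → 0ℚ < ι H → 1ℚ ≤ ι Q * q → 0ℚ ≤ q →
    ∃[ T′ ] T′ ℕ.< H ℕ.* Q ℕ.^ ℓ × ι T′ * q ^ ℓ ≤ ι H × ι H ≤ ι (suc T′) * q ^ ℓ
  ∃-rounds Q ℓ H {q} 0<H 1≤Qq 0≤q = first-crossing (q ^ ℓ) (ι H) (H ℕ.* Q ℕ.^ ℓ) 0<H
    (subst₂ _≤_ (*-identityʳ (ι H)) eq (*-monoˡ (0≤ι H) (1≤^ ℓ 1≤Qq)))
    where
    eq : ι H * (ι Q * q) ^ ℓ ≡ ι (H ℕ.* Q ℕ.^ ℓ) * q ^ ℓ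
    eq = trans (cong (ι H *_) (^-distrib-* (ι Q) q ℓ))
      (trans (sym (*-assoc (ι H) (ι Q ^ ℓ) (q ^ ℓ)))
        (cong (_* q ^ ℓ) (sym (trans (ι-* H (Q ℕ.^ ℓ)) (cong (ι H *_) (ι-^ Q ℓ))))))

  module _ (Q R : ℕ) {δ : ℚ} (1≤Rδ : 1ℚ ≤ ι R * δ) (0<R : 0 ℕ.< R)
    (p : ℚ) (0≤p : 0ℚ ≤ p) (p≤1 : p ≤ 1ℚ) (1≤Qp : 1ℚ ≤ ι Q * p) (nA′ nB′ : ℕ)
    (U : Graph (suc nA′) (suc nB′) → ℕ) (χ′ₛ≤U : ∀ G → χ′ₛ G ℕ.≤ U G)
    (U-cheap : ι (4 ℕ.* (Q ℕ.* Q) ℕ.* R) * 𝔼 (graphᴱ p 0≤p p≤1 (suc nA′) (suc nB′)) (λ G → ι (U G))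
               ≤ ι (suc nA′ ℕ.* suc nB′))
    where

    private
      nA nB c : ℕ
      nA = suc nA′
      nB = suc nB′
      c = 4 ℕ.* (Q ℕ.* Q)
      D : Expectation (Graph nA nB)
      D = graphᴱ p 0≤p p≤1 nA nB
      success? : ∀ (G : Graph nA nB) → Dec (χ′ₛ G ℕ.≤ ΔA G ℕ.* ΔB G)
      success? G = χ′ₛ G ℕ.≤? ΔA G ℕ.* ΔB G
      lowA? : ∀ (G : Graph nA nB) → Dec (2 ℕ.* Q ℕ.* ∣ neighboursA G zero ∣ ℕ.≤ nB)
      lowA? G = 2 ℕ.* Q ℕ.* ∣ neighboursA G zero ∣ ℕ.≤? nB
      lowB? : ∀ (G : Graph nA nB) → Dec (2 ℕ.* Q ℕ.* ∣ neighboursB G zero ∣ ℕ.≤ nA)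
      lowB? G = 2 ℕ.* Q ℕ.* ∣ neighboursB G zero ∣ ℕ.≤? nA
      expensive? : ∀ G → Dec (nA ℕ.* nB ℕ.≤ c ℕ.* U G)
      expensive? G = nA ℕ.* nB ℕ.≤? c ℕ.* U G

      -- The union bound as a pointwise inequality: a graph that is cheap to colour and has high
      -- degrees at both examined vertices is a success.
      union : ∀ G → 1ℚ ≤ indicator (success? G) +
        (indicator (expensive? G) + (indicator (lowA? G) + indicator (lowB? G)))
      union G = 1≤indicator+ (success? G)
        (0≤+ (0≤indicator (expensive? G)) (0≤+ (0≤indicator (lowA? G)) (0≤indicator (lowB? G)))) λ failure →
        1≤indicator+ (expensive? G) (0≤+ (0≤indicator (lowA? G)) (0≤indicator (lowB? G))) λ cheap →
        1≤indicator+ (lowA? G) (0≤indicator (lowB? G)) λ A-high →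
        subst (1ℚ ≤_) (+-identityʳ (indicator (lowB? G))) (1≤indicator+ (lowB? G) ≤-refl λ B-high →
          contradiction (ℕ.≤-trans (χ′ₛ≤U G) (ℕ.≤-trans (≤-from-degrees Q cheap A-high B-high)
            (ℕ.*-mono-≤ (degree≤ΔA G zero) (degree≤ΔB G zero)))) failure)

      expensive-unlikely : 𝔼 D (indicator ∘ expensive?) ≤ δ
      expensive-unlikely = markov-inverse D expensive? (λ G → ι c * ι (U G)) R
        (0<ι {nA ℕ.* nB} z<s) (0<ι 0<R) 1≤Rδ
        (λ G → 0≤* (0≤ι c) (0≤ι (U G)))
        (λ G expensive → subst (ι (nA ℕ.* nB) ≤_) (ι-* c (U G)) (ι-mono expensive))
        (subst (_≤ ι (nA ℕ.* nB)) rescale U-cheap)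
        where
        rescale : ι (c ℕ.* R) * 𝔼 D (λ G → ι (U G)) ≡ ι R * 𝔼 D (λ G → ι c * ι (U G))
        rescale = trans (cong (_* 𝔼 D (λ G → ι (U G))) (ι-* c R))
          (trans (solve 3 (λ c r e → c :* r :* e := r :* (c :* e)) refl (ι c) (ι R) (𝔼 D (λ G → ι (U G))))
            (cong (ι R *_) (sym (𝔼-* D (ι c) (λ G → ι (U G))))))

    success-probability : c ℕ.* R ℕ.≤ nA → c ℕ.* R ℕ.≤ nB → 1ℚ ≤ 𝔼 D (indicator ∘ success?) + (δ + (δ + δ))
    success-probability A-large B-large = ≤-trans
      (subst₂ _≤_ (𝔼-1 D)
        (trans (𝔼-+ D i₀ (λ G → i₁ G + (i₂ G + i₃ G))) (cong (𝔼 D i₀ +_)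
          (trans (𝔼-+ D i₁ (λ G → i₂ G + i₃ G)) (cong (𝔼 D i₁ +_) (𝔼-+ D i₂ i₃)))))
        (𝔼-mono D union))
      (+-monoʳ-≤ (𝔼 D i₀) (+-mono-≤ expensive-unlikely (+-mono-≤
        (low-degree-A p 0≤p p≤1 Q R nA′ nB′ 1≤Qp (0<ι 0<R) 1≤Rδ B-large)
        (low-degree-B p 0≤p p≤1 Q R nA′ nB′ 1≤Qp (0<ι 0<R) 1≤Rδ A-large))))
      where
      i₀ i₁ i₂ i₃ : Graph nA nB → ℚ
      i₀ = indicator ∘ success?
      i₁ = indicator ∘ expensive?
      i₂ = indicator ∘ lowA?
      i₃ = indicator ∘ lowB?

  -- h, H, k′ and S are variables constrained by equations because Agda would otherwise
  -- unfold these numerals when it compares types.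
  module _ (Q R : ℕ) {δ : ℚ} (1≤Rδ : 1ℚ ≤ ι R * δ) (0<Q : 0 ℕ.< Q) (0<R : 0 ℕ.< R)
    (h H k′ S : ℕ) (h≡ : h ≡ 4 ℕ.* (Q ℕ.* Q) ℕ.* R) (H≡ : H ≡ 3 ℕ.* h) (k-large : H ℕ.* suc H ℕ.≤ suc k′)
    (S≡ : S ≡ H ℕ.* Q ℕ.^ length (offDiagonal (suc k′)))
    where

    private
      0<H : 0 ℕ.< H
      0<H = subst (0 ℕ.<_) (sym (trans H≡ (cong (3 ℕ.*_) h≡)))
        (ℕ.*-mono-< {0} {3} z<s (ℕ.*-mono-< {0} {4 ℕ.* (Q ℕ.* Q)} (ℕ.*-mono-< {0} {4} z<s (ℕ.*-mono-< 0<Q 0<Q)) 0<R))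

      ℓ : ℕ
      ℓ = length (offDiagonal (suc k′))

    -- In the bound on the sizes, the first term keeps the leftovers cheap for every number of
    -- rounds up to `S`; the second is what Chebyshev's inequality asks for.
    success-probability-large : ∀ nA nB → 0 ℕ.< nA → 0 ℕ.< nB →
      2 ℕ.* (H ℕ.* suc k′ ℕ.^ S) ℕ.+ h ℕ.≤ nA → 2 ℕ.* (H ℕ.* suc k′ ℕ.^ S) ℕ.+ h ℕ.≤ nB →
      ∀ p (0≤p : 0ℚ ≤ p) (p≤1 : p ≤ 1ℚ) → 1ℚ ≤ ι Q * p → 1ℚ ≤ ι Q * (1ℚ - p) →
      1ℚ ≤ 𝔼 (graphᴱ p 0≤p p≤1 nA nB) (λ G → indicator (χ′ₛ G ℕ.≤? ΔA G ℕ.* ΔB G)) + (δ + (δ + δ))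
    success-probability-large (suc nA′) (suc nB′) _ _ A-large B-large p 0≤p p≤1 1≤Qp 1≤Qq =
      from-rounds (∃-rounds Q ℓ H (0<ι 0<H) 1≤Qq (p≤q⇒0≤q-p p≤1))
      where
      nA nB : ℕ
      nA = suc nA′
      nB = suc nB′
      D : Expectation (Graph nA nB)
      D = graphᴱ p 0≤p p≤1 nA nB
      c : ℕ
      c = 4 ℕ.* (Q ℕ.* Q)
      from-rounds : (∃[ T′ ] T′ ℕ.< H ℕ.* Q ℕ.^ ℓ × ι T′ * (1ℚ - p) ^ ℓ ≤ ι H × ι H ≤ ι (suc T′) * (1ℚ - p) ^ ℓ) →
        1ℚ ≤ 𝔼 D (λ G → indicator (χ′ₛ G ℕ.≤? ΔA G ℕ.* ΔB G)) + (δ + (δ + δ))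
      from-rounds (T′ , T′<S , T′ρ≤H , H≤Tρ) = success-probability Q R 1≤Rδ 0<R p 0≤p p≤1 1≤Qp nA′ nB′ U
        (proj₁ (proj₂ (proj₂ (cover k′ T′ p 0≤p p≤1 nA nB))))
        (*-cancelˡ (0<ι {3} z<s) (subst (_≤ ι 3 * ι (nA ℕ.* nB)) rescale
          (cover-cheap k′ T′ p 0≤p p≤1 H nA nB k-large (ℕ.≤-trans blocks A-large) (ℕ.≤-trans blocks B-large) T′ρ≤H H≤Tρ)))
        (h-large A-large) (h-large B-large)
        where
        U : Graph nA nB → ℕ
        U = proj₁ (cover k′ T′ p 0≤p p≤1 nA nB)
        rescale : ι H * 𝔼 D (λ G → ι (U G)) ≡ ι 3 * (ι (c ℕ.* R) * 𝔼 D (λ G → ι (U G)))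
        rescale = trans (cong (_* 𝔼 D (λ G → ι (U G))) (trans (cong ι (trans H≡ (cong (3 ℕ.*_) h≡))) (ι-* 3 (c ℕ.* R))))
          (*-assoc (ι 3) (ι (c ℕ.* R)) (𝔼 D (λ G → ι (U G))))
        blocks : 2 ℕ.* (H ℕ.* suc k′ ℕ.^ suc T′) ℕ.≤ 2 ℕ.* (H ℕ.* suc k′ ℕ.^ S) ℕ.+ h
        blocks = ℕ.≤-trans
          (ℕ.*-monoʳ-≤ 2 (ℕ.*-monoʳ-≤ H (ℕ.^-monoʳ-≤ (suc k′) (subst (T′ ℕ.<_) (sym S≡) T′<S))))
          (ℕ.m≤m+n (2 ℕ.* (H ℕ.* suc k′ ℕ.^ S)) h)
        h-large : ∀ {n} → 2 ℕ.* (H ℕ.* suc k′ ℕ.^ S) ℕ.+ h ℕ.≤ n → c ℕ.* R ℕ.≤ n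
        h-large {n} n-large = subst (ℕ._≤ n) h≡ (ℕ.≤-trans (ℕ.m≤n+m h (2 ℕ.* (H ℕ.* suc k′ ℕ.^ S))) n-large)

  threshold : ∀ Q R {δ} → 1ℚ ≤ ι R * δ → 0 ℕ.< Q → 0 ℕ.< R → ∃[ N ]
    ∀ nA nB → 0 ℕ.< nA → 0 ℕ.< nB → N ℕ.≤ nA → N ℕ.≤ nB →
    ∀ p (0≤p : 0ℚ ≤ p) (p≤1 : p ≤ 1ℚ) → 1ℚ ≤ ι Q * p → 1ℚ ≤ ι Q * (1ℚ - p) →
    1ℚ ≤ 𝔼 (graphᴱ p 0≤p p≤1 nA nB) (λ G → indicator (χ′ₛ G ℕ.≤? ΔA G ℕ.* ΔB G)) + (δ + (δ + δ))
  threshold Q R 1≤Rδ 0<Q 0<R = _ , success-probability-large Q R 1≤Rδ 0<Q 0<R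
    -- With k′ = H (H + 1) the side k = `suc k′` exceeds the required value by one and is visibly
    -- positive.
    h H (H ℕ.* suc H) _ refl refl (ℕ.n≤1+n (H ℕ.* suc H)) refl
    where
    h H : ℕ
    h = 4 ℕ.* (Q ℕ.* Q) ℕ.* R
    H = 3 ℕ.* h

  -- Passage to a real edge probability

  quarter-pos : ∀ {η} → 0ℚ < η → 0ℚ < ½ * ½ * η
  quarter-pos {η} 0<η = subst (_< ½ * ½ * η) (*-zeroʳ (½ * ½)) (*-monoʳ-<-pos (½ * ½) 0<η)

  module _ (p ε : ℝ) where

    success-tends-to-1 : 0ℝ Defs.< p → p Defs.< 1ℝ → 0ℝ Defs.< ε →
      ∃[ N ] ∀ nA nB → 0 ℕ.< nA → 0 ℕ.< nB → N ℕ.≤ nA ⊓ nB →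
      abs (ℙ nA nB p (λ G → χ′ₛ G ℕ.≤? ΔA G ℕ.* ΔB G) Defs.- 1ℝ) Defs.< ε
    success-tends-to-1 (κ₀ , 0<κ₀ , K₀ , κ₀≤p) (κ₁ , 0<κ₁ , K₁ , p≤1-κ₁) (η , 0<η , K , η≤ε)
      with Q₀ , 1≤Q₀κ₀ ← 1/-inverse 0<κ₀
      with Q₁ , 1≤Q₁κ₁ ← 1/-inverse 0<κ₁
      with R′ , 1≤R′δ ← 1/-inverse (quarter-pos 0<η) =
      N , λ nA nB 0<nA 0<nB N≤ → δ , 0<δ , K₀ ⊔ (K₁ ⊔ K) , λ k k≥ → close nA nB 0<nA 0<nB N≤ k
        (κ₀≤p k (ℕ.m⊔n≤o⇒m≤o K₀ _ k≥))
        (p≤1-κ₁ k (ℕ.m⊔n≤o⇒m≤o K₁ K (ℕ.m⊔n≤o⇒n≤o K₀ _ k≥)))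
        (η≤ε k (ℕ.m⊔n≤o⇒n≤o K₁ K (ℕ.m⊔n≤o⇒n≤o K₀ _ k≥)))
      where
      δ : ℚ
      -- Three quarters of `η` bound the three failure probabilities; the fourth is the gap that the
      -- strict inequality between reals demands.
      δ = ½ * ½ * η
      0<δ : 0ℚ < δ
      0<δ = quarter-pos 0<η
      Q′ : ℕ
      -- One integer that bounds the reciprocals of both `p` and 1 - `p`; its successor is then
      -- positive by its form.
      Q′ = Q₀ ℕ.+ Q₁
      inverse-mono : ∀ m n {x y} → m ℕ.≤ n → 0ℚ < x → x ≤ y → 1ℚ ≤ ι m * x → 1ℚ ≤ ι n * y
      inverse-mono m n m≤n 0<x x≤y 1≤mx = ≤-trans 1≤mx (*-mono (0≤ι n) (<⇒≤ 0<x) (ι-mono m≤n) x≤y)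
      uniform = threshold (suc Q′) (suc R′) {δ} (inverse-mono R′ (suc R′) (ℕ.n≤1+n R′) 0<δ ≤-refl 1≤R′δ) z<s z<s
      N : ℕ
      N = proj₁ uniform
      close : ∀ nA nB → 0 ℕ.< nA → 0 ℕ.< nB → N ℕ.≤ nA ⊓ nB → ∀ k →
        0ℚ + κ₀ ≤ p .seq k → p .seq k + κ₁ ≤ 1ℚ → 0ℚ + η ≤ ε .seq k →
        ℚ.∣ ℙ nA nB p (λ G → χ′ₛ G ℕ.≤? ΔA G ℕ.* ΔB G) .seq k - 1ℚ ∣ + δ ≤ ε .seq k
      close nA nB 0<nA 0<nB N≤ k κ₀≤ ≤1-κ₁ η≤ = subst (λ x → x + δ ≤ ε .seq k)
        (trans (trans (sym (0≤p⇒∣p∣≡p (p≤q⇒0≤q-p P≤1))) (trans (sym (∣-p∣≡∣p∣ (1ℚ - P)))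
          (cong ℚ.∣_∣ (solve 1 (λ x → :- (con 1ℚ :- x) := x :- con 1ℚ) refl P))))
          (cong (λ x → ℚ.∣ x - 1ℚ ∣) (sym ℙ≡P)))
        (≤-trans (+-monoˡ-≤ δ 1-P≤3δ) (≤-trans
          (≤-reflexive (solve 1 (λ η → let δ = con (½ * ½) :* η in (δ :+ (δ :+ δ)) :+ δ := con 0ℚ :+ η) refl η)) η≤))
        where
        q = p .seq k
        κ₀≤q : κ₀ ≤ q
        κ₀≤q = subst (_≤ q) (+-identityˡ κ₀) κ₀≤
        κ₁≤1-q : κ₁ ≤ 1ℚ - q
        κ₁≤1-q = subst (_≤ 1ℚ - q) (solve 2 (λ q κ → q :+ κ :- q := κ) refl q κ₁) (+-monoˡ-≤ (- q) ≤1-κ₁)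
        0≤q : 0ℚ ≤ q
        0≤q = ≤-trans (<⇒≤ 0<κ₀) κ₀≤q
        q≤1 : q ≤ 1ℚ
        q≤1 = 0≤q-p⇒p≤q (≤-trans (<⇒≤ 0<κ₁) κ₁≤1-q)
        D : Expectation (Graph nA nB)
        D = graphᴱ q 0≤q q≤1 nA nB
        success? : ∀ (G : Graph nA nB) → Dec (χ′ₛ G ℕ.≤ ΔA G ℕ.* ΔB G)
        success? G = χ′ₛ G ℕ.≤? ΔA G ℕ.* ΔB G
        P : ℚ
        P = 𝔼 D (λ G → indicator (success? G))
        ℙ≡P : ℙ nA nB p success? .seq k ≡ P
        ℙ≡P = ℙ-seq nA nB p success? k 0≤q q≤1
        P≤1 : P ≤ 1ℚ
        P≤1 = subst (P ≤_) (𝔼-1 D) (𝔼-mono D λ G → indicator-≤1 (success? G))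
        1-P≤3δ : 1ℚ - P ≤ δ + (δ + δ)
        1-P≤3δ = subst (1ℚ - P ≤_) (solve 2 (λ P d → P :+ d :- P := d) refl P (δ + (δ + δ)))
          (+-monoˡ-≤ (- P) (proj₂ uniform nA nB 0<nA 0<nB
            (ℕ.≤-trans N≤ (ℕ.m⊓n≤m nA nB)) (ℕ.≤-trans N≤ (ℕ.m⊓n≤n nA nB)) q 0≤q q≤1
            (inverse-mono Q₀ (suc Q′) (ℕ.m≤n⇒m≤1+n (ℕ.m≤m+n Q₀ Q₁)) 0<κ₀ κ₀≤q 1≤Q₀κ₀)
            (inverse-mono Q₁ (suc Q′) (ℕ.m≤n⇒m≤1+n (ℕ.m≤n+m Q₁ Q₀)) 0<κ₁ κ₁≤1-q 1≤Q₁κ₁)))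

open import Defs
open import Data.Nat.Base as ℕ using (ℕ; _⊔_; _⊓_)
open import Data.Nat.Properties using (_≤?_)
open import Data.Product using (∃-syntax; _,_)

theorem1p4 : (p Cₐᵣ : ℝ) → 0ℝ < p → p < 1ℝ → 1ℝ ≤ Cₐᵣ →
    ∀ ε → 0ℝ < ε →
    ∃[ N ] ∀ (nA nB : ℕ) → 0 ℕ.< nA → 0 ℕ.< nB →
    fromℕ (nA ⊔ nB) ≤ Cₐᵣ * fromℕ (nA ⊓ nB) →
    N ℕ.≤ nA ⊓ nB →
    abs (ℙ nA nB p (λ G → χ′ₛ G ≤? ΔA G ℕ.* ΔB G) - 1ℝ) < ε
theorem1p4 p Cₐᵣ 0<p p<1 _ ε 0<ε =
  let N , close = success-tends-to-1 p ε 0<p p<1 0<ε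
  in N , λ nA nB 0<nA 0<nB _ N≤ → close nA nB 0<nA 0<nB N≤
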